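{- There exists $C>0$ such that for all $g\ge3$, every graph $G=(V,E)$ on $n$ vertices with girth at least $g$ and maximum degree $\Delta$, every integer $k>2\Delta$, and every partition of $V$ into disjoint blocks $V=B_1\cup B_2\cup\dots\cup B_N$ with $\mathrm{diameter}(B_i)\le g/2-3$ for all $i$, the mixing time of the block dynamics satisfies $T_{\mathrm{mix}}\le C\Delta n\log n$.
   Context: The block dynamics with blocks $B_1,\dots,B_N$ on the set of proper $k$-colorings of $G$: at each step choose a block $B_i$ uniformly at random and replace the coloring on $B_i$ by a uniformly random proper $k$-coloring of $G$ that agrees with the current coloring outside $B_i$. The mixing time is the minimum $T$ such that from any initial proper coloring the distribution after $T$ steps is within total variation distance $1/4$ of the uniform distribution on proper $k$-colorings.
   Formalization: The maximum degree Δ is assumed to be at least 1: for Δ = 0 the bound CΔn log n is 0, while the mixing time is positive (for example one vertex and k = 2), so the statement fails there. -}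

module Defs where

open import Data.Bool using (if_then_else_)
open import Data.Fin using (Fin; zero; suc; inject₁; fromℕ; _≟_)
open import Data.Fin.Properties using (all?)
open import Data.Fin.Subset using (Subset; Nonempty; _∈_; _∉_)
open import Data.Fin.Subset.Properties using (_∈?_)
open import Data.Integer using (+_)
open import Data.List using (List; []; _∷_; map; filter; length; foldr; allFin; cartesianProductWith)
open import Data.List.Extrema.Nat using (max)
open import Data.Nat using (ℕ; zero; suc; _≤_; _^_)
open import Data.Product using (_×_; ∃-syntax)
open import Data.Rational using (ℚ; 0ℚ; 1ℚ; ½; ∣_∣; _/_) renaming (_+_ to _+ℚ_; _*_ to _*ℚ_; _-_ to _-ℚ_; _≤_ to _≤ℚ_)
open import Data.Vec using (Vec; []; _∷_; lookup)
open import Data.Vec.Properties using (≡-dec)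
open import Function using (Injective)
open import Level using (0ℓ)
open import Relation.Binary using (Rel; Decidable; Symmetric)
open import Relation.Binary.PropositionalEquality using (_≡_; _≢_)
open import Relation.Nullary using (¬_; Dec; does; ¬?; _×-dec_; _→-dec_)

record Graph (n : ℕ) : Set₁ where
  field
    Adj     : Rel (Fin n) 0ℓ
    adj?    : Decidable Adj
    adj-sym : Symmetric Adj
    no-loop : ∀ v → ¬ Adj v v

module _ {n : ℕ} (G : Graph n) where
  open Graph G

  degree : Fin n → ℕ
  degree v = length (filter (adj? v) (allFin n))

  maxDegree : ℕ
  maxDegree = max 0 (map degree (allFin n))

  -- A cycle with suc m vertices c 0, …, c m.
  record IsCycle {m : ℕ} (c : Fin (suc m) → Fin n) : Set where
    field
      length≥3  : 3 ≤ suc m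
      injective : Injective _≡_ _≡_ c
      step      : ∀ (i : Fin m) → Adj (c (inject₁ i)) (c (suc i))
      close     : Adj (c (fromℕ m)) (c zero)

  -- A forest has infinite girth, so it satisfies this for every g.
  GirthAtLeast : ℕ → Set
  GirthAtLeast g = ∀ {m} (c : Fin (suc m) → Fin n) → IsCycle c → g ≤ suc m

  data Walk : Fin n → Fin n → ℕ → Set where
    here : ∀ {v} → Walk v v 0
    _◅_  : ∀ {u v w ℓ} → Adj u v → Walk v w ℓ → Walk u w (suc ℓ)

  IsDistance : Fin n → Fin n → ℕ → Set
  IsDistance u v d = Walk u v d × (∀ ℓ → Walk u v ℓ → d ≤ ℓ)

  -- Distances are taken in G, not in the subgraph induced by B.
  record IsDiameter (B : Subset n) (d : ℕ) : Set where
    field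
      attained : ∃[ u ] ∃[ v ] (u ∈ B × v ∈ B × IsDistance u v d)
      bound    : ∀ u v → u ∈ B → v ∈ B → ∃[ d′ ] (IsDistance u v d′ × d′ ≤ d)

record IsPartition {n N : ℕ} (B : Fin N → Subset n) : Set where
  field
    nonempty : ∀ i → Nonempty (B i)
    disjoint : ∀ i j v → v ∈ B i → v ∈ B j → i ≡ j
    covers   : ∀ v → ∃[ i ] (v ∈ B i)

Coloring : ℕ → ℕ → Set
Coloring n k = Vec (Fin k) n

allColorings : ∀ n k → List (Coloring n k)
allColorings zero    k = [] ∷ []
allColorings (suc n) k = cartesianProductWith _∷_ (allFin k) (allColorings n k)

sumℚ : {A : Set} → List A → (A → ℚ) → ℚ
sumℚ xs f = foldr _+ℚ_ 0ℚ (map f xs)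

-- The value at 0 is junk: below, the argument is the size of a set that is
-- nonempty in every case of interest.
1/ : ℕ → ℚ
1/ zero    = 0ℚ
1/ (suc m) = + 1 / suc m

module _ {n : ℕ} (G : Graph n) (k : ℕ) where
  open Graph G

  Proper : Coloring n k → Set
  Proper σ = ∀ u v → Adj u v → lookup σ u ≢ lookup σ v

  proper? : ∀ σ → Dec (Proper σ)
  proper? σ = all? λ u → all? λ v → adj? u v →-dec ¬? (lookup σ u ≟ lookup σ v)

  properColorings : List (Coloring n k)
  properColorings = filter proper? (allColorings n k)

  uniform : ℚ
  uniform = 1/ (length properColorings)

  AgreeOutside : Subset n → Coloring n k → Coloring n k → Set
  AgreeOutside B σ τ = ∀ v → v ∉ B → lookup τ v ≡ lookup σ v

  IsRecoloring : Subset n → Coloring n k → Coloring n k → Set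
  IsRecoloring B σ τ = Proper τ × AgreeOutside B σ τ

  isRecoloring? : ∀ B σ τ → Dec (IsRecoloring B σ τ)
  isRecoloring? B σ τ = proper? τ ×-dec all? λ v → ¬? (v ∈? B) →-dec (lookup τ v ≟ lookup σ v)

  recolorings : Subset n → Coloring n k → List (Coloring n k)
  recolorings B σ = filter (isRecoloring? B σ) (allColorings n k)

  updateProb : Subset n → Coloring n k → Coloring n k → ℚ
  updateProb B σ τ = if does (isRecoloring? B σ τ) then 1/ (length (recolorings B σ)) else 0ℚ

  module _ {N : ℕ} (B : Fin N → Subset n) where

    transition : Coloring n k → Coloring n k → ℚ
    transition σ τ = 1/ N *ℚ sumℚ (allFin N) (λ i → updateProb (B i) σ τ)

    -- distribution t σ τ is the probability that the chain started at σ is at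
    -- τ after t steps.
    distribution : ℕ → Coloring n k → Coloring n k → ℚ
    distribution zero    σ τ = if does (≡-dec _≟_ σ τ) then 1ℚ else 0ℚ
    distribution (suc t) σ τ = sumℚ properColorings (λ ρ → distribution t σ ρ *ℚ transition ρ τ)

    tvToUniform : ℕ → Coloring n k → ℚ
    tvToUniform t σ = ½ *ℚ sumℚ properColorings (λ τ → ∣ distribution t σ τ -ℚ uniform ∣)

    MixedAt : ℕ → Set
    MixedAt t = ∀ σ → Proper σ → tvToUniform t σ ≤ℚ + 1 / 4

    IsMixingTime : ℕ → Set
    IsMixingTime T = MixedAt T × (∀ t → MixedAt t → T ≤ t)

-- For n ≥ 1, exactly the real inequality T ≤ a · log₂ n (both sides exponentiated).
_≤_·log₂_ : ℕ → ℕ → ℕ → Set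
T ≤ a ·log₂ n = 2 ^ T ≤ n ^ a

infix 4 _≤_·log₂_

{-# OPTIONS --safe #-}
-- Functions of colourings are contracted instead of coupling colourings. Let D = Δ + 1, so
-- that every vertex always has at least k - Δ ≥ D free colours, and give v the weight one plus
-- the number of its neighbours outside its own block.
--
-- Say that f oscillates by at most a u at u when recolouring u changes f by at most a u. A heat
-- bath step at u removes the oscillation at u and adds a u / D at each neighbour of u. Resampling
-- a block B is unaffected by preceding heat bath steps inside B, so these may be used to push
-- all oscillation out of B (Dobrushin's comparison). If f oscillates by L times the weight, then
-- the total pushed away from u ∈ B is at most L · (weight u + number of neighbours in B) ≤ L · D,
-- so resampling B adds at most L per neighbour in B to a vertex outside B. Averaging over the
-- blocks, one step of the dynamics multiplies L by at most 1 - 1 / (N · D). Applied to the sign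
-- of the deviation from uniformity this bounds the total variation distance after t steps by
-- (1 - 1 / (N · D)) ^ t · n · D.
module Submission where

open import Defs
open import Data.Bool using (true; false; if_then_else_)
open import Data.Empty using (⊥-elim)
open import Data.Fin using (Fin; zero; suc; _≟_)
open import Data.Fin.Properties using (suc-injective; any?; all?; injective⇒≤)
open import Data.Fin.Subset using (Subset; _∈_; _∉_)
open import Data.Fin.Subset.Properties using (_∈?_)
import Data.Integer as ℤ
import Data.Integer.Properties as ℤ
open import Data.List using (List; []; _∷_; map; filter; length; allFin; cartesianProductWith; _++_)
open import Data.List.Extrema.Nat using (xs≤max; max<v⁺)
open import Data.List.Membership.Propositional using (lose) renaming (_∈_ to _∈ˡ_)
open import Data.List.Membership.Propositional.Properties using (∈-allFin; ∈-cartesianProductWith⁺; ∈-filter⁺; ∈-filter⁻; ∈-length; ∈-map⁺)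
open import Data.List.Properties using (filter-notAll; filter-≐; length-tabulate; map-tabulate)
import Data.List.Relation.Unary.All as All
import Data.List.Relation.Unary.All.Properties as All
open import Data.List.Relation.Unary.Any using (here; there)
open import Data.Nat using (ℕ; zero; suc)
import Data.Nat as ℕ
open import Data.Nat.Coprimality using (Coprime)
import Data.Nat.Properties as ℕ
import Data.Nat.Solver as ℕ
open import Data.Product using (_×_; _,_; proj₁; proj₂; ∃-syntax)
open import Data.Sum using (_⊎_; inj₁; inj₂)
open import Data.Vec using ([]; _∷_; lookup; _[_]≔_)
open import Data.Vec.Properties using (≡-dec; ∷-injective; []≔-lookup; []≔-idempotent; []≔-commutes; lookup∘update; lookup∘update′)
open import Function using (_∘_)
open import Relation.Binary.PropositionalEquality using (_≡_; _≢_; refl; sym; trans; cong; cong₂; subst; module ≡-Reasoning)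
open import Relation.Nullary using (¬_; ¬?; Dec; yes; no; does; map′; _×-dec_; _→-dec_)

-- Single-vertex changes lead out of the proper colourings, so oscillation is defined over all
-- colourings, and both the heat bath and the block update are extended to improper ones; only the
-- comparison with the chain is restricted to proper starts.
--
-- The weights make the books balance. A vertex `v` receives `L` per neighbour from every block
-- other than its own, in total `L * (weight v - 1)`, while its own block erases `L * weight v`. The
-- net loss, summed over the blocks, is exactly `L`, and since weights are at most `D` this is at
-- least a fraction `1 / D` of `L * weight v`. At the same time weight plus inner degree is one plus
-- the degree, hence at most `D`, which closes the induction that bounds the oscillation fired
-- inside a block.
--
-- A block is emptied of oscillation only in the limit of infinitely many heat bath steps. No limit
-- is formed: the total fired is bounded, so an error that persists at every stage has bounded
-- multiples, and the Archimedean property makes it nonpositive.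

module Mixing where
  open import Data.Rational using (ℚ; mkℚ; 0ℚ; 1ℚ; ½; ∣_∣; _/_; _+_; _*_; _-_; -_; _≤_; *≤*; nonNegative; toℚᵘ)
  open import Data.Rational.Properties
    using ( ≤-refl; ≤-reflexive; ≤-trans; ≤-total; _≤?_; ≰⇒>; <⇒≤; nonNegative⁻¹; neg-antimono-≤
          ; +-mono-≤; +-monoˡ-≤; +-monoʳ-≤; +-identityˡ; +-identityʳ; +-assoc; +-comm; +-inverseʳ
          ; *-comm; *-assoc; *-zeroˡ; *-zeroʳ; *-identityˡ; *-identityʳ; *-distribˡ-+
          ; *-monoˡ-≤-nonNeg; *-monoʳ-≤-nonNeg; 0≤p⇒∣p∣≡p; ∣-p∣≡∣p∣; normalize-nonNeg
          ; toℚᵘ-injective; toℚᵘ-cancel-≤; toℚᵘ-homo-*; toℚᵘ-homo-+; toℚᵘ-fromℚᵘ; module ≤-Reasoning )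
  open import Data.Rational.Solver using (module +-*-Solver)
  import Data.Rational.Unnormalised as ℚᵘ
  import Data.Rational.Unnormalised.Properties as ℚᵘ
  open +-*-Solver using (solve; _:=_; _:+_; _:*_; _:-_; :-_; con)

  private variable
    A A′ : Set

  -- Inequalities between rationals

  ≤-diff : ∀ {x y d} → 0ℚ ≤ d → y ≡ x + d → x ≤ y
  ≤-diff {x} 0≤d refl = ≤-trans (≤-reflexive (sym (+-identityʳ x))) (+-monoʳ-≤ x 0≤d)

  diff-nonneg : ∀ {x y} → x ≤ y → 0ℚ ≤ y - x
  diff-nonneg {x} {y} x≤y = ≤-trans (≤-reflexive (sym (+-inverseʳ x))) (+-monoˡ-≤ (- x) x≤y)

  *-nonneg : ∀ {x y} → 0ℚ ≤ x → 0ℚ ≤ y → 0ℚ ≤ x * y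
  *-nonneg {x} {y} 0≤x 0≤y =
    ≤-trans (≤-reflexive (sym (*-zeroʳ x))) (*-monoˡ-≤-nonNeg x {{nonNegative 0≤x}} 0≤y)

  +-nonneg : ∀ {x y} → 0ℚ ≤ x → 0ℚ ≤ y → 0ℚ ≤ x + y
  +-nonneg 0≤x 0≤y = ≤-trans (≤-reflexive (sym (+-identityʳ 0ℚ))) (+-mono-≤ 0≤x 0≤y)

  *-monoˡ : ∀ {c x y} → 0ℚ ≤ c → x ≤ y → c * x ≤ c * y
  *-monoˡ {c} 0≤c = *-monoˡ-≤-nonNeg c {{nonNegative 0≤c}}

  *-monoʳ : ∀ {c x y} → 0ℚ ≤ c → x ≤ y → x * c ≤ y * c
  *-monoʳ {c} 0≤c = *-monoʳ-≤-nonNeg c {{nonNegative 0≤c}}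

  0≤1 : 0ℚ ≤ 1ℚ
  0≤1 = nonNegative⁻¹ 1ℚ

  -- Naturals and their reciprocals inside the rationals

  ι : ℕ → ℚ
  ι n = ℤ.+ n / 1

  -- `ι` normalises its fraction by a gcd that does not reduce on a variable, so the equation is
  -- checked among unnormalised rationals, where only cross products have to agree.
  ι-suc : ∀ n → ι (suc n) ≡ 1ℚ + ι n
  ι-suc n = toℚᵘ-injective (begin
    toℚᵘ (ι (suc n))                  ≈⟨ toℚᵘ-fromℚᵘ (ℚᵘ.mkℚᵘ (ℤ.+ suc n) 0) ⟩
    ℚᵘ.mkℚᵘ (ℤ.+ suc n) 0               ≈⟨ ℚᵘ.*≡* (cong (λ m → (ℤ.+ 1 ℤ.+ m) ℤ.* ℤ.+ 1) (sym (ℤ.*-identityʳ (ℤ.+ n)))) ⟩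
    ℚᵘ.1ℚᵘ ℚᵘ.+ ℚᵘ.mkℚᵘ (ℤ.+ n) 0       ≈⟨ ℚᵘ.+-congʳ ℚᵘ.1ℚᵘ (ℚᵘ.≃-sym (toℚᵘ-fromℚᵘ (ℚᵘ.mkℚᵘ (ℤ.+ n) 0))) ⟩
    ℚᵘ.1ℚᵘ ℚᵘ.+ toℚᵘ (ι n)            ≈⟨ ℚᵘ.≃-sym (toℚᵘ-homo-+ 1ℚ (ι n)) ⟩
    toℚᵘ (1ℚ + ι n)                   ∎)
    where open ℚᵘ.≃-Reasoning

  1/-* : ∀ n → 0 ℕ.< n → 1/ n * ι n ≡ 1ℚ
  1/-* (suc m) _ = toℚᵘ-injective (begin
    toℚᵘ (1/ (suc m) * ι (suc m))          ≈⟨ toℚᵘ-homo-* (1/ (suc m)) (ι (suc m)) ⟩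
    toℚᵘ (1/ (suc m)) ℚᵘ.* toℚᵘ (ι (suc m)) ≈⟨ ℚᵘ.*-cong (toℚᵘ-fromℚᵘ (ℚᵘ.mkℚᵘ (ℤ.+ 1) m)) (toℚᵘ-fromℚᵘ (ℚᵘ.mkℚᵘ (ℤ.+ suc m) 0)) ⟩
    ℚᵘ.mkℚᵘ (ℤ.+ 1) m ℚᵘ.* ℚᵘ.mkℚᵘ (ℤ.+ suc m) 0 ≈⟨ ℚᵘ.*≡* (trans (ℤ.*-identityʳ _) (cong ℤ.+_ (cong (ℕ._+ 0) (sym (ℕ.*-identityʳ (suc m)))))) ⟩
    ℚᵘ.1ℚᵘ                                 ∎)
    where open ℚᵘ.≃-Reasoning

  0≤ι : ∀ n → 0ℚ ≤ ι n
  0≤ι n = nonNegative⁻¹ (ι n) {{normalize-nonNeg n 1}}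

  0≤1/ : ∀ n → 0ℚ ≤ 1/ n
  0≤1/ zero    = ≤-refl
  0≤1/ (suc m) = nonNegative⁻¹ (1/ (suc m)) {{normalize-nonNeg 1 (suc m)}}

  ι-mono : ∀ {m n} → m ℕ.≤ n → ι m ≤ ι n
  ι-mono {n = n} ℕ.z≤n       = 0≤ι n
  ι-mono {suc m} {suc n} (ℕ.s≤s m≤n) =
    ≤-trans (≤-reflexive (ι-suc m)) (≤-trans (+-monoʳ-≤ 1ℚ (ι-mono m≤n)) (≤-reflexive (sym (ι-suc n))))

  ι-+ : ∀ m n → ι (m ℕ.+ n) ≡ ι m + ι n
  ι-+ zero    n = sym (+-identityˡ (ι n))
  ι-+ (suc m) n = trans (ι-suc (m ℕ.+ n)) (trans (cong (1ℚ +_) (ι-+ m n))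
    (trans (sym (+-assoc 1ℚ (ι m) (ι n))) (cong (_+ ι n) (sym (ι-suc m)))))

  ι-* : ∀ m n → ι (m ℕ.* n) ≡ ι m * ι n
  ι-* zero    n = sym (*-zeroˡ (ι n))
  ι-* (suc m) n = trans (ι-+ n (m ℕ.* n)) (trans (cong (ι n +_) (ι-* m n))
    (trans (solve 2 (λ x y → y :+ x :* y := (con 1ℚ :+ x) :* y) refl (ι m) (ι n)) (cong (_* ι n) (sym (ι-suc m)))))

  -- Indicators of decidable propositions

  𝟙 : {P : Set} → Dec P → ℚ
  𝟙 d = if does d then 1ℚ else 0ℚ

  𝟙-yes : {P : Set} (d : Dec P) → P → 𝟙 d ≡ 1ℚ
  𝟙-yes (yes _) _ = refl
  𝟙-yes (no ¬p) p = ⊥-elim (¬p p)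

  𝟙-no : {P : Set} (d : Dec P) → ¬ P → 𝟙 d ≡ 0ℚ
  𝟙-no (yes p) ¬p = ⊥-elim (¬p p)
  𝟙-no (no _)  _  = refl

  𝟙-nonneg : {P : Set} (d : Dec P) → 0ℚ ≤ 𝟙 d
  𝟙-nonneg (yes _) = 0≤1
  𝟙-nonneg (no _)  = ≤-refl

  𝟙-≤1 : {P : Set} (d : Dec P) → 𝟙 d ≤ 1ℚ
  𝟙-≤1 (yes _) = ≤-refl
  𝟙-≤1 (no _)  = 0≤1

  𝟙-cong : {P Q : Set} (d : Dec P) (e : Dec Q) → (P → Q) → (Q → P) → 𝟙 d ≡ 𝟙 e
  𝟙-cong (yes p) e f g = sym (𝟙-yes e (f p))
  𝟙-cong (no ¬p) e f g = sym (𝟙-no e (¬p ∘ g))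

  𝟙-× : {P Q : Set} (d : Dec P) (e : Dec Q) → 𝟙 (d ×-dec e) ≡ 𝟙 d * 𝟙 e
  𝟙-× (yes _) (yes _) = refl
  𝟙-× (yes _) (no _)  = refl
  𝟙-× (no _)  (yes _) = refl
  𝟙-× (no _)  (no _)  = refl

  -- Finite sums

  sum-cong-∈ : (xs : List A) {f g : A → ℚ} → (∀ {x} → x ∈ˡ xs → f x ≡ g x) → sumℚ xs f ≡ sumℚ xs g
  sum-cong-∈ []       f≡g = refl
  sum-cong-∈ (x ∷ xs) f≡g = cong₂ _+_ (f≡g (here refl)) (sum-cong-∈ xs (f≡g ∘ there))

  sum-cong : (xs : List A) {f g : A → ℚ} → (∀ x → f x ≡ g x) → sumℚ xs f ≡ sumℚ xs g
  sum-cong xs f≡g = sum-cong-∈ xs (λ {x} _ → f≡g x)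

  sum-mono-∈ : (xs : List A) {f g : A → ℚ} → (∀ {x} → x ∈ˡ xs → f x ≤ g x) → sumℚ xs f ≤ sumℚ xs g
  sum-mono-∈ []       f≤g = ≤-refl
  sum-mono-∈ (x ∷ xs) f≤g = +-mono-≤ (f≤g (here refl)) (sum-mono-∈ xs (f≤g ∘ there))

  sum-mono : (xs : List A) {f g : A → ℚ} → (∀ x → f x ≤ g x) → sumℚ xs f ≤ sumℚ xs g
  sum-mono xs f≤g = sum-mono-∈ xs (λ {x} _ → f≤g x)

  sum-zero : (xs : List A) → sumℚ xs (λ _ → 0ℚ) ≡ 0ℚ
  sum-zero []       = refl
  sum-zero (x ∷ xs) = trans (+-identityˡ _) (sum-zero xs)

  sum-nonneg : (xs : List A) {f : A → ℚ} → (∀ x → 0ℚ ≤ f x) → 0ℚ ≤ sumℚ xs f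
  sum-nonneg xs 0≤f = ≤-trans (≤-reflexive (sym (sum-zero xs))) (sum-mono xs 0≤f)

  sum-+ : (xs : List A) (f g : A → ℚ) → sumℚ xs (λ x → f x + g x) ≡ sumℚ xs f + sumℚ xs g
  sum-+ []       f g = refl
  sum-+ (x ∷ xs) f g = trans (cong (f x + g x +_) (sum-+ xs f g))
    (solve 4 (λ a b c d → (a :+ b) :+ (c :+ d) := (a :+ c) :+ (b :+ d)) refl (f x) (g x) (sumℚ xs f) (sumℚ xs g))

  sum-*ˡ : (xs : List A) (c : ℚ) (f : A → ℚ) → sumℚ xs (λ x → c * f x) ≡ c * sumℚ xs f
  sum-*ˡ []       c f = sym (*-zeroʳ c)
  sum-*ˡ (x ∷ xs) c f = trans (cong (c * f x +_) (sum-*ˡ xs c f)) (sym (*-distribˡ-+ c (f x) (sumℚ xs f)))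

  sum-*ʳ : (xs : List A) (c : ℚ) (f : A → ℚ) → sumℚ xs (λ x → f x * c) ≡ sumℚ xs f * c
  sum-*ʳ xs c f = trans (sum-cong xs (λ x → *-comm (f x) c)) (trans (sum-*ˡ xs c f) (*-comm c _))

  sum-- : (xs : List A) (f g : A → ℚ) → sumℚ xs (λ x → f x - g x) ≡ sumℚ xs f - sumℚ xs g
  sum-- []       f g = refl
  sum-- (x ∷ xs) f g = trans (cong (f x - g x +_) (sum-- xs f g))
    (solve 4 (λ a b c d → (a :- b) :+ (c :- d) := (a :+ c) :- (b :+ d)) refl (f x) (g x) (sumℚ xs f) (sumℚ xs g))

  sum-one : (xs : List A) → sumℚ xs (λ _ → 1ℚ) ≡ ι (length xs)
  sum-one []       = refl
  sum-one (x ∷ xs) = trans (cong (1ℚ +_) (sum-one xs)) (sym (ι-suc (length xs)))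

  sum-const : (xs : List A) (c : ℚ) → sumℚ xs (λ _ → c) ≡ ι (length xs) * c
  sum-const xs c = trans (sum-cong xs (λ _ → sym (*-identityˡ c))) (trans (sum-*ʳ xs c (λ _ → 1ℚ)) (cong (_* c) (sum-one xs)))

  sum-swap : (xs : List A) (ys : List A′) (f : A → A′ → ℚ) →
    sumℚ xs (λ x → sumℚ ys (f x)) ≡ sumℚ ys (λ y → sumℚ xs (λ x → f x y))
  sum-swap []       ys f = sym (sum-zero ys)
  sum-swap (x ∷ xs) ys f = trans (cong (sumℚ ys (f x) +_) (sum-swap xs ys f)) (sym (sum-+ ys (f x) (λ y → sumℚ xs (λ x′ → f x′ y))))

  sum-filter : {P : A → Set} (P? : ∀ x → Dec (P x)) (xs : List A) (f : A → ℚ) →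
    sumℚ (filter P? xs) f ≡ sumℚ xs (λ x → 𝟙 (P? x) * f x)
  sum-filter P? []       f = refl
  sum-filter P? (x ∷ xs) f with P? x
  ... | yes _ = cong₂ _+_ (sym (*-identityˡ (f x))) (sum-filter P? xs f)
  ... | no  _ = trans (sum-filter P? xs f) (sym (trans (cong (_+ _) (*-zeroˡ (f x))) (+-identityˡ _)))

  length-filter : {P : A → Set} (P? : ∀ x → Dec (P x)) (xs : List A) →
    ι (length (filter P? xs)) ≡ sumℚ xs (λ x → 𝟙 (P? x))
  length-filter P? xs = trans (sym (sum-one (filter P? xs)))
    (trans (sum-filter P? xs (λ _ → 1ℚ)) (sum-cong xs (λ x → *-identityʳ _)))

  sum-++ : (xs ys : List A) (f : A → ℚ) → sumℚ (xs ++ ys) f ≡ sumℚ xs f + sumℚ ys f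
  sum-++ []       ys f = sym (+-identityˡ _)
  sum-++ (x ∷ xs) ys f = trans (cong (f x +_) (sum-++ xs ys f)) (sym (+-assoc (f x) _ _))

  sum-map : (xs : List A) (h : A → A′) (f : A′ → ℚ) → sumℚ (map h xs) f ≡ sumℚ xs (f ∘ h)
  sum-map []       h f = refl
  sum-map (x ∷ xs) h f = cong (f (h x) +_) (sum-map xs h f)

  sum-allFin-suc : ∀ n (f : Fin (suc n) → ℚ) → sumℚ (allFin (suc n)) f ≡ f zero + sumℚ (allFin n) (f ∘ suc)
  sum-allFin-suc n f = cong (f zero +_)
    (trans (cong (λ xs → sumℚ xs f) (sym (map-tabulate (λ i → i) suc))) (sum-map (allFin n) suc f))

  sum-δ : ∀ {n} (j : Fin n) (f : Fin n → ℚ) → sumℚ (allFin n) (λ i → 𝟙 (j ≟ i) * f i) ≡ f j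
  sum-δ {suc n} zero f = begin
    sumℚ (allFin (suc n)) (λ i → 𝟙 (zero ≟ i) * f i)                      ≡⟨ sum-allFin-suc n (λ i → 𝟙 (zero ≟ i) * f i) ⟩
    1ℚ * f zero + sumℚ (allFin n) (λ i → 0ℚ * f (suc i))                  ≡⟨ cong₂ _+_ (*-identityˡ (f zero)) (trans (sum-cong (allFin n) (λ i → *-zeroˡ (f (suc i)))) (sum-zero (allFin n))) ⟩
    f zero + 0ℚ                                                           ≡⟨ +-identityʳ _ ⟩
    f zero                                                                ∎
    where open ≡-Reasoning
  sum-δ {suc n} (suc j) f = begin
    sumℚ (allFin (suc n)) (λ i → 𝟙 (suc j ≟ i) * f i)                     ≡⟨ sum-allFin-suc n (λ i → 𝟙 (suc j ≟ i) * f i) ⟩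
    0ℚ * f zero + sumℚ (allFin n) (λ i → 𝟙 (suc j ≟ suc i) * f (suc i))   ≡⟨ cong₂ _+_ (*-zeroˡ (f zero)) (sum-cong (allFin n) (λ i → cong (_* f (suc i)) (𝟙-cong (suc j ≟ suc i) (j ≟ i) suc-injective (cong suc)))) ⟩
    0ℚ + sumℚ (allFin n) (λ i → 𝟙 (j ≟ i) * f (suc i))                    ≡⟨ +-identityˡ _ ⟩
    sumℚ (allFin n) (λ i → 𝟙 (j ≟ i) * f (suc i))                         ≡⟨ sum-δ j (f ∘ suc) ⟩
    f (suc j)                                                             ∎
    where open ≡-Reasoning

  -- Sums over colourings

  sum-allColorings-suc : ∀ n k (f : Coloring (suc n) k → ℚ) →
    sumℚ (allColorings (suc n) k) f ≡ sumℚ (allFin k) (λ c → sumℚ (allColorings n k) (λ ρ → f (c ∷ ρ)))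
  sum-allColorings-suc n k f = go (allFin k)
    where
    go : ∀ cs → sumℚ (cartesianProductWith _∷_ cs (allColorings n k)) f ≡ sumℚ cs (λ c → sumℚ (allColorings n k) (λ ρ → f (c ∷ ρ)))
    go []       = refl
    go (c ∷ cs) = trans (sum-++ (map (c ∷_) (allColorings n k)) _ f) (cong₂ _+_ (sum-map (allColorings n k) (c ∷_) f) (go cs))

  sum-δ-coloring : ∀ {n k} (σ : Coloring n k) (f : Coloring n k → ℚ) →
    sumℚ (allColorings n k) (λ τ → 𝟙 (≡-dec _≟_ σ τ) * f τ) ≡ f σ
  sum-δ-coloring []      f = trans (+-identityʳ _) (*-identityˡ (f []))
  sum-δ-coloring {suc n} {k} (x ∷ σ) f = begin
    sumℚ (allColorings (suc n) k) (λ τ → 𝟙 (≡-dec _≟_ (x ∷ σ) τ) * f τ)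
      ≡⟨ sum-allColorings-suc n k _ ⟩
    sumℚ (allFin k) (λ c → sumℚ (allColorings n k) (λ ρ → 𝟙 (≡-dec _≟_ (x ∷ σ) (c ∷ ρ)) * f (c ∷ ρ)))
      ≡⟨ sum-cong (allFin k) (λ c → trans (sum-cong (allColorings n k) (λ ρ → factor c ρ)) (sum-*ˡ (allColorings n k) (𝟙 (x ≟ c)) _)) ⟩
    sumℚ (allFin k) (λ c → 𝟙 (x ≟ c) * sumℚ (allColorings n k) (λ ρ → 𝟙 (≡-dec _≟_ σ ρ) * f (c ∷ ρ)))
      ≡⟨ sum-cong (allFin k) (λ c → cong (𝟙 (x ≟ c) *_) (sum-δ-coloring σ (f ∘ (c ∷_)))) ⟩
    sumℚ (allFin k) (λ c → 𝟙 (x ≟ c) * f (c ∷ σ))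
      ≡⟨ sum-δ x (λ c → f (c ∷ σ)) ⟩
    f (x ∷ σ) ∎
    where
    open ≡-Reasoning
    factor : ∀ c ρ → 𝟙 (≡-dec _≟_ (x ∷ σ) (c ∷ ρ)) * f (c ∷ ρ) ≡ 𝟙 (x ≟ c) * (𝟙 (≡-dec _≟_ σ ρ) * f (c ∷ ρ))
    factor c ρ = trans (cong (_* f (c ∷ ρ))
      (trans (𝟙-cong (≡-dec _≟_ (x ∷ σ) (c ∷ ρ)) ((x ≟ c) ×-dec ≡-dec _≟_ σ ρ) ∷-injective (λ (p , q) → cong₂ _∷_ p q)) (𝟙-× (x ≟ c) (≡-dec _≟_ σ ρ))))
      (*-assoc (𝟙 (x ≟ c)) _ _)

  -- Averages

  avg : List A → (A → ℚ) → ℚ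
  avg xs f = 1/ (length xs) * sumℚ xs f

  avg-const : (xs : List A) → 0 ℕ.< length xs → ∀ c → avg xs (λ _ → c) ≡ c
  avg-const xs 0<n c = trans (cong (1/ (length xs) *_) (sum-const xs c))
    (trans (sym (*-assoc (1/ (length xs)) _ c)) (trans (cong (_* c) (1/-* (length xs) 0<n)) (*-identityˡ c)))

  avg-cong : (xs : List A) {f g : A → ℚ} → (∀ x → f x ≡ g x) → avg xs f ≡ avg xs g
  avg-cong xs f≡g = cong (1/ (length xs) *_) (sum-cong xs f≡g)

  avg-mono-∈ : (xs : List A) {f g : A → ℚ} → (∀ {x} → x ∈ˡ xs → f x ≤ g x) → avg xs f ≤ avg xs g
  avg-mono-∈ xs f≤g = *-monoˡ (0≤1/ (length xs)) (sum-mono-∈ xs f≤g)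

  avg-+ : (xs : List A) (f g : A → ℚ) → avg xs (λ x → f x + g x) ≡ avg xs f + avg xs g
  avg-+ xs f g = trans (cong (1/ (length xs) *_) (sum-+ xs f g)) (*-distribˡ-+ (1/ (length xs)) _ _)

  avg-+const : (xs : List A) → 0 ℕ.< length xs → ∀ f c → avg xs (λ x → f x + c) ≡ avg xs f + c
  avg-+const xs 0<n f c = trans (avg-+ xs f (λ _ → c)) (cong (avg xs f +_) (avg-const xs 0<n c))

  avg-≤ : (xs : List A) → 0 ℕ.< length xs → ∀ {f c} → (∀ {x} → x ∈ˡ xs → f x ≤ c) → avg xs f ≤ c
  avg-≤ xs 0<n {c = c} f≤c = ≤-trans (avg-mono-∈ xs f≤c) (≤-reflexive (avg-const xs 0<n c))

  avg-≥ : (xs : List A) → 0 ℕ.< length xs → ∀ {f c} → (∀ {x} → x ∈ˡ xs → c ≤ f x) → c ≤ avg xs f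
  avg-≥ xs 0<n {c = c} c≤f = ≤-trans (≤-reflexive (sym (avg-const xs 0<n c))) (avg-mono-∈ xs c≤f)

  -- Asking for the bound on every pair amounts to using the independent coupling of the two uniform
  -- measures, so the lists may have different lengths.
  avg-cross : (xs : List A) (ys : List A′) → 0 ℕ.< length xs → 0 ℕ.< length ys → ∀ {f g b} →
    (∀ {x y} → x ∈ˡ xs → y ∈ˡ ys → f x ≤ g y + b) → avg xs f ≤ avg ys g + b
  avg-cross xs ys 0<m 0<n {f} {g} {b} h =
    ≤-trans (avg-≥ ys 0<n (λ y∈ → avg-≤ xs 0<m (λ x∈ → h x∈ y∈))) (≤-reflexive (avg-+const ys 0<n g b))

  ≤-+⇒nonneg : ∀ {p q} → p ≤ p + q → 0ℚ ≤ q
  ≤-+⇒nonneg {p} {q} h = ≤-trans (diff-nonneg h)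
    (≤-reflexive (solve 2 (λ p q → (p :+ q) :- p := q) refl p q))

  sum-≥-term : (xs : List A) {f : A → ℚ} → (∀ x → 0ℚ ≤ f x) → ∀ {y} → y ∈ˡ xs → f y ≤ sumℚ xs f
  sum-≥-term (x ∷ xs) {f} 0≤f (here refl) = ≤-diff (sum-nonneg xs 0≤f) refl
  sum-≥-term (x ∷ xs) {f} 0≤f (there y∈)  = ≤-trans (sum-≥-term xs 0≤f y∈) (≤-diff (0≤f x) (+-comm (f x) (sumℚ xs f)))

  ι-cancel-≤ : ∀ {m n} → ι m ≤ ι n → m ℕ.≤ n
  ι-cancel-≤ {m} {n} h with m ℕ.≤? n
  ... | yes p = p
  ... | no ¬p = ⊥-elim (¬1≤0 (≤-trans 1≤diff (≤-reflexive (+-inverseʳ (ι n)))))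
    where
    ¬1≤0 : ¬ (1ℚ ≤ 0ℚ)
    ¬1≤0 (Data.Rational.*≤* (ℤ.+≤+ ()))
    1≤diff : 1ℚ ≤ ι n - ι n
    1≤diff = ≤-trans (≤-reflexive (solve 1 (λ a → con 1ℚ := (con 1ℚ :+ a) :- a) refl (ι n)))
      (+-monoˡ-≤ (- ι n) (≤-trans (≤-reflexive (sym (ι-suc n))) (≤-trans (ι-mono (ℕ.≰⇒> ¬p)) h)))

  1/-antimono : ∀ {m n} → 0 ℕ.< m → m ℕ.≤ n → 1/ n ≤ 1/ m
  1/-antimono {m} {n} 0<m m≤n = begin
    1/ n                    ≡⟨ sym (*-identityʳ (1/ n)) ⟩
    1/ n * 1ℚ               ≡⟨ cong (1/ n *_) (sym (1/-* m 0<m)) ⟩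
    1/ n * (1/ m * ι m)     ≤⟨ *-monoˡ (0≤1/ n) (*-monoˡ (0≤1/ m) (ι-mono m≤n)) ⟩
    1/ n * (1/ m * ι n)     ≡⟨ solve 3 (λ a b c → a :* (b :* c) := (a :* c) :* b) refl (1/ n) (1/ m) (ι n) ⟩
    (1/ n * ι n) * 1/ m     ≡⟨ cong (_* 1/ m) (1/-* n (ℕ.≤-trans 0<m m≤n)) ⟩
    1ℚ * 1/ m               ≡⟨ *-identityˡ (1/ m) ⟩
    1/ m                    ∎
    where open ≤-Reasoning

  -- Averages over two lists that differ by one exchange

  argmin : ∀ {k} (F : Fin (suc k) → ℚ) → ∃[ c ] (∀ c′ → F c ≤ F c′)
  argmin {zero}  F = zero , λ { zero → ≤-refl }
  argmin {suc k} F with argmin (F ∘ suc)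
  ... | c , min with ≤-total (F zero) (F (suc c))
  ...   | inj₁ h = zero , λ { zero → ≤-refl ; (suc c′) → ≤-trans h (min c′) }
  ...   | inj₂ h = suc c , λ { zero → h ; (suc c′) → min c′ }

  module _ {k D : ℕ} (0<D : 0 ℕ.< D) {P Q : Fin k → Set} (P? : ∀ c → Dec (P c)) (Q? : ∀ c → Dec (Q c)) where
    private
      Ps = filter P? (allFin k)
      Qs = filter Q? (allFin k)

    -- Up to the one element `x`, `Ps` lies in `Qs`, so its sum is larger by at most `F x ≤ ℓ`.
    -- Dividing by the longer length `p` does not enlarge the first term, because `F` is
    -- nonnegative, and turns the surplus into at most `ℓ / D`.
    avg-exchange-nonneg : D ℕ.≤ length Qs → length Qs ℕ.≤ length Ps →
      ∀ x → (∀ c → c ≢ x → P c → Q c) →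
      (F : Fin k → ℚ) (ℓ : ℚ) → (∀ c → 0ℚ ≤ F c) → (∀ c → F c ≤ ℓ) →
      avg Ps F ≤ avg Qs F + 1/ D * ℓ
    avg-exchange-nonneg D≤Q Q≤P x P⊆Q F ℓ 0≤F F≤ℓ = begin
      1/ p * sumℚ Ps F                   ≤⟨ *-monoˡ (0≤1/ p) sums ⟩
      1/ p * (sumℚ Qs F + ℓ)             ≡⟨ *-distribˡ-+ (1/ p) (sumℚ Qs F) ℓ ⟩
      1/ p * sumℚ Qs F + 1/ p * ℓ        ≤⟨ +-mono-≤ (*-monoʳ (sum-nonneg Qs 0≤F) (1/-antimono (ℕ.≤-trans 0<D D≤Q) Q≤P))
                                              (*-monoʳ (≤-trans (0≤F x) (F≤ℓ x)) (1/-antimono 0<D (ℕ.≤-trans D≤Q Q≤P))) ⟩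
      1/ q * sumℚ Qs F + 1/ D * ℓ        ∎
      where
      open ≤-Reasoning
      p = length Ps
      q = length Qs
      pointwise : ∀ c → 𝟙 (P? c) * F c ≤ 𝟙 (Q? c) * F c + 𝟙 (x ≟ c) * F c
      pointwise c with x ≟ c
      ... | yes refl = ≤-trans (≤-trans (*-monoʳ (0≤F x) (𝟙-≤1 (P? x))) (≤-reflexive (sym (+-identityˡ (1ℚ * F x)))))
              (+-monoˡ-≤ (1ℚ * F x) (*-nonneg (𝟙-nonneg (Q? x)) (0≤F x)))
      ... | no x≢c = ≤-trans (*-monoʳ (0≤F c) P≤Q) (≤-diff (*-nonneg ≤-refl (0≤F c)) refl)
        where
        P≤Q : 𝟙 (P? c) ≤ 𝟙 (Q? c)
        P≤Q with P? c
        ... | yes pc = ≤-reflexive (sym (𝟙-yes (Q? c) (P⊆Q c (x≢c ∘ sym) pc)))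
        ... | no  _  = 𝟙-nonneg (Q? c)
      sums : sumℚ Ps F ≤ sumℚ Qs F + ℓ
      sums = begin
        sumℚ Ps F                                                      ≡⟨ sum-filter P? (allFin k) F ⟩
        sumℚ (allFin k) (λ c → 𝟙 (P? c) * F c)                         ≤⟨ sum-mono (allFin k) pointwise ⟩
        sumℚ (allFin k) (λ c → 𝟙 (Q? c) * F c + 𝟙 (x ≟ c) * F c)       ≡⟨ sum-+ (allFin k) (λ c → 𝟙 (Q? c) * F c) (λ c → 𝟙 (x ≟ c) * F c) ⟩
        sumℚ (allFin k) (λ c → 𝟙 (Q? c) * F c) + sumℚ (allFin k) (λ c → 𝟙 (x ≟ c) * F c)
          ≡⟨ cong₂ _+_ (sym (sum-filter Q? (allFin k) F)) (sum-δ x F) ⟩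
        sumℚ Qs F + F x                                                ≤⟨ +-monoʳ-≤ (sumℚ Qs F) (F≤ℓ x) ⟩
        sumℚ Qs F + ℓ                                                  ∎

  -- Subtracting a constant from `F` shifts both averages equally; once the minimum is subtracted,
  -- the values lie between `0` and `ℓ`.
  avg-exchange-≤ : ∀ {k D} → 0 ℕ.< D → {P Q : Fin k → Set} (P? : ∀ c → Dec (P c)) (Q? : ∀ c → Dec (Q c)) →
    D ℕ.≤ length (filter Q? (allFin k)) → length (filter Q? (allFin k)) ℕ.≤ length (filter P? (allFin k)) →
    ∀ x → (∀ c → c ≢ x → P c → Q c) →
    (F : Fin k → ℚ) (ℓ : ℚ) → (∀ c c′ → F c ≤ F c′ + ℓ) →
    avg (filter P? (allFin k)) F ≤ avg (filter Q? (allFin k)) F + 1/ D * ℓ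
  avg-exchange-≤ {suc k} {D} 0<D P? Q? D≤Q Q≤P x P⊆Q F ℓ F≤ with argmin F
  ... | c₀ , min = begin
    avg Ps F                             ≡⟨ shift Ps (ℕ.≤-trans 0<D (ℕ.≤-trans D≤Q Q≤P)) ⟩
    avg Ps F′ + F c₀                     ≤⟨ +-monoˡ-≤ (F c₀) (avg-exchange-nonneg 0<D P? Q? D≤Q Q≤P x P⊆Q F′ ℓ
                                               (λ c → diff-nonneg (min c))
                                               (λ c → ≤-trans (+-monoˡ-≤ (- F c₀) (F≤ c c₀))
                                                  (≤-reflexive (solve 2 (λ a b → (a :+ b) :- a := b) refl (F c₀) ℓ)))) ⟩
    (avg Qs F′ + 1/ D * ℓ) + F c₀        ≡⟨ solve 3 (λ a b c → (a :+ b) :+ c := (a :+ c) :+ b) refl (avg Qs F′) (1/ D * ℓ) (F c₀) ⟩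
    (avg Qs F′ + F c₀) + 1/ D * ℓ        ≡⟨ cong (_+ 1/ D * ℓ) (sym (shift Qs (ℕ.≤-trans 0<D D≤Q))) ⟩
    avg Qs F + 1/ D * ℓ                  ∎
    where
    open ≤-Reasoning
    Ps = filter P? (allFin (suc k))
    Qs = filter Q? (allFin (suc k))
    F′ : Fin (suc k) → ℚ
    F′ c = F c - F c₀
    shift : ∀ xs → 0 ℕ.< length xs → avg xs F ≡ avg xs F′ + F c₀
    shift xs 0<xs = trans (avg-cong xs (λ c → solve 2 (λ a b → a := (a :- b) :+ b) refl (F c) (F c₀))) (avg-+const xs 0<xs F′ (F c₀))

  avg-neg : (xs : List A) (F : A → ℚ) → avg xs (λ x → - F x) ≡ - avg xs F
  avg-neg xs F = trans (cong (1/ (length xs) *_) (trans (sum-cong xs (λ x → solve 1 (λ a → :- a := con (- 1ℚ) :* a) refl (F x))) (sum-*ˡ xs (- 1ℚ) F)))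
    (solve 2 (λ a b → a :* (con (- 1ℚ) :* b) := :- (a :* b)) refl (1/ (length xs)) (sumℚ xs F))

  -- If `Qs` is the longer list, the roles are swapped and `F` is negated, which gives the same
  -- inequality. Hence only one `ℓ / D` is paid, although each list may contain an element missing
  -- from the other.
  avg-exchange : ∀ {k D} → 0 ℕ.< D → {P Q : Fin k → Set} (P? : ∀ c → Dec (P c)) (Q? : ∀ c → Dec (Q c)) →
    D ℕ.≤ length (filter P? (allFin k)) → D ℕ.≤ length (filter Q? (allFin k)) →
    ∀ x y → (∀ c → c ≢ x → P c → Q c) → (∀ c → c ≢ y → Q c → P c) →
    (F : Fin k → ℚ) (ℓ : ℚ) → (∀ c c′ → F c ≤ F c′ + ℓ) →
    avg (filter P? (allFin k)) F ≤ avg (filter Q? (allFin k)) F + 1/ D * ℓ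
  avg-exchange {k} {D} 0<D P? Q? D≤P D≤Q x y P⊆Q Q⊆P F ℓ F≤
    with ℕ.≤-total (length (filter Q? (allFin k))) (length (filter P? (allFin k)))
  ... | inj₁ Q≤P = avg-exchange-≤ 0<D P? Q? D≤Q Q≤P x P⊆Q F ℓ F≤
  ... | inj₂ P≤Q = ≤-diff (diff-nonneg neg≤)
    (trans (solve 3 (λ a b e → b :+ e := a :+ ((:- a :+ e) :- (:- b))) refl (avg Ps F) (avg Qs F) (1/ D * ℓ))
       (cong₂ (λ s t → avg Ps F + ((s + 1/ D * ℓ) - t)) (sym (avg-neg Ps F)) (sym (avg-neg Qs F))))
    where
    Ps = filter P? (allFin k)
    Qs = filter Q? (allFin k)
    neg≤ : avg Qs (λ c → - F c) ≤ avg Ps (λ c → - F c) + 1/ D * ℓ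
    neg≤ = avg-exchange-≤ 0<D Q? P? D≤P P≤Q y Q⊆P (λ c → - F c) ℓ
      (λ c c′ → ≤-diff (diff-nonneg (F≤ c′ c)) (solve 3 (λ a b e → (:- b) :+ e := (:- a) :+ ((a :+ e) :- b)) refl (F c) (F c′) ℓ))

  -- Oscillation of functions of colourings

  record Osc {n k : ℕ} (f : Coloring n k → ℚ) (a : Fin n → ℚ) : Set where
    constructor osc-by
    field
      osc-bound : ∀ σ v x → f (σ [ v ]≔ x) ≤ f σ + a v

  open Osc

  -- Giving `v` the colour it already has changes nothing, so this is an instance of the bound. A
  -- colouring is an argument because `Osc` is vacuous when none exists.
  osc-nonneg : ∀ {n k} {f : Coloring n k → ℚ} {a} → Osc f a → Coloring n k → ∀ v → 0ℚ ≤ a v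
  osc-nonneg {f = f} {a} osc σ v = ≤-+⇒nonneg (subst (λ τ → f τ ≤ f σ + a v) ([]≔-lookup σ v) (osc-bound osc σ v (lookup σ v)))

  -- The walk from `σ` to `τ` changes one coordinate at a time and may pass through improper
  -- colourings. Coordinates where the two agree cost nothing, so `b` has to dominate `a` only at
  -- the others.
  osc-total : ∀ {n k} {f : Coloring n k → ℚ} {a b} → Osc f a → (∀ v → 0ℚ ≤ b v) →
    ∀ σ τ → (∀ v → lookup σ v ≡ lookup τ v ⊎ a v ≤ b v) → f τ ≤ f σ + sumℚ (allFin n) b
  osc-total {f = f} osc 0≤b [] [] h = ≤-reflexive (sym (+-identityʳ (f [])))
  osc-total {suc n} {f = f} {a} {b} osc 0≤b (x ∷ σ) (y ∷ τ) h = begin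
    f (y ∷ τ)                                                     ≤⟨ first (h zero) ⟩
    f (x ∷ τ) + b zero                                            ≤⟨ +-monoˡ-≤ (b zero) (osc-total {f = λ ρ → f (x ∷ ρ)} {a = a ∘ suc} (osc-by λ ρ v → osc-bound osc (x ∷ ρ) (suc v)) (0≤b ∘ suc) σ τ (h ∘ suc)) ⟩
    (f (x ∷ σ) + sumℚ (allFin n) (b ∘ suc)) + b zero              ≡⟨ solve 3 (λ p q r → (p :+ q) :+ r := p :+ (r :+ q)) refl (f (x ∷ σ)) (sumℚ (allFin n) (b ∘ suc)) (b zero) ⟩
    f (x ∷ σ) + (b zero + sumℚ (allFin n) (b ∘ suc))              ≡⟨ cong (f (x ∷ σ) +_) (sym (sum-allFin-suc n b)) ⟩
    f (x ∷ σ) + sumℚ (allFin (suc n)) b                           ∎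
    where
    open ≤-Reasoning
    first : x ≡ y ⊎ a zero ≤ b zero → f (y ∷ τ) ≤ f (x ∷ τ) + b zero
    first (inj₁ refl) = ≤-diff (0≤b zero) refl
    first (inj₂ a≤b)  = ≤-trans (osc-bound osc (x ∷ τ) zero y) (+-monoʳ-≤ (f (x ∷ τ)) a≤b)

  -- The heat bath at one vertex

  module HeatBath {n : ℕ} (k D : ℕ) (G : Graph n) (0<D : 0 ℕ.< D) (D-slack : ∀ u → degree G u ℕ.+ D ℕ.≤ k) where
    open Graph G

    Free : Fin n → Coloring n k → Fin k → Set
    Free u σ c = ∀ v → Adj u v → c ≢ lookup σ v

    free? : ∀ u σ c → Dec (Free u σ c)
    free? u σ c = all? λ v → adj? u v →-dec ¬? (c ≟ lookup σ v)

    free : Fin n → Coloring n k → List (Fin k)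
    free u σ = filter (free? u σ) (allFin k)

    heat : Fin n → (Coloring n k → ℚ) → Coloring n k → ℚ
    heat u f σ = avg (free u σ) (λ c → f (σ [ u ]≔ c))

    -- Every colour is free at `u` or worn by a neighbour, and a neighbour wears only one colour;
    -- counting pairs gives `k ≤ length (free u σ) + degree G u`.
    free-length : ∀ u σ → D ℕ.≤ length (free u σ)
    free-length u σ = ι-cancel-≤ (≤-diff (diff-nonneg D+deg≤free+deg)
      (solve 3 (λ a b c → c := b :+ ((c :+ a) :- (a :+ b))) refl (ι (degree G u)) (ι D) (ι (length (free u σ)))))
      where
      open ≤-Reasoning
      blocked : Fin k → Fin n → ℚ
      blocked c v = 𝟙 (adj? u v) * 𝟙 (lookup σ v ≟ c)
      blocked-nonneg : ∀ c v → 0ℚ ≤ blocked c v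
      blocked-nonneg c v = *-nonneg (𝟙-nonneg (adj? u v)) (𝟙-nonneg (lookup σ v ≟ c))
      cover : ∀ c → 1ℚ ≤ 𝟙 (free? u σ c) + sumℚ (allFin n) (blocked c)
      cover c with any? (λ v → adj? u v ×-dec (lookup σ v ≟ c))
      ... | yes (v , uv , σv≡c) = begin
        1ℚ                                                 ≡⟨ sym (cong₂ _*_ (𝟙-yes (adj? u v) uv) (𝟙-yes (lookup σ v ≟ c) σv≡c)) ⟩
        blocked c v                                        ≤⟨ sum-≥-term (allFin n) (blocked-nonneg c) (∈-allFin v) ⟩
        sumℚ (allFin n) (blocked c)                        ≤⟨ ≤-diff (𝟙-nonneg (free? u σ c)) (+-comm (𝟙 (free? u σ c)) (sumℚ (allFin n) (blocked c))) ⟩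
        𝟙 (free? u σ c) + sumℚ (allFin n) (blocked c)      ∎
      ... | no none = ≤-diff (sum-nonneg (allFin n) (blocked-nonneg c))
        (cong (_+ sumℚ (allFin n) (blocked c)) (𝟙-yes (free? u σ c) (λ v uv c≡ → none (v , uv , sym c≡))))
      blocked-total : sumℚ (allFin k) (λ c → sumℚ (allFin n) (blocked c)) ≡ ι (degree G u)
      blocked-total = begin-equality
        sumℚ (allFin k) (λ c → sumℚ (allFin n) (blocked c))
          ≡⟨ sum-swap (allFin k) (allFin n) blocked ⟩
        sumℚ (allFin n) (λ v → sumℚ (allFin k) (λ c → 𝟙 (adj? u v) * 𝟙 (lookup σ v ≟ c)))
          ≡⟨ sum-cong (allFin n) (λ v → trans (sum-*ˡ (allFin k) (𝟙 (adj? u v)) (λ c → 𝟙 (lookup σ v ≟ c)))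
               (trans (cong (𝟙 (adj? u v) *_) (trans (sum-cong (allFin k) (λ c → sym (*-identityʳ (𝟙 (lookup σ v ≟ c))))) (sum-δ (lookup σ v) (λ _ → 1ℚ))))
                 (*-identityʳ (𝟙 (adj? u v))))) ⟩
        sumℚ (allFin n) (λ v → 𝟙 (adj? u v))
          ≡⟨ sym (length-filter (adj? u) (allFin n)) ⟩
        ι (degree G u) ∎
      D+deg≤free+deg : ι (degree G u) + ι D ≤ ι (length (free u σ)) + ι (degree G u)
      D+deg≤free+deg = begin
        ι (degree G u) + ι D                                                        ≡⟨ sym (ι-+ (degree G u) D) ⟩
        ι (degree G u ℕ.+ D)                                                        ≤⟨ ι-mono (D-slack u) ⟩
        ι k                                                                         ≡⟨ cong ι (sym (length-tabulate (λ (c : Fin k) → c))) ⟩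
        ι (length (allFin k))                                                       ≡⟨ sym (sum-one (allFin k)) ⟩
        sumℚ (allFin k) (λ _ → 1ℚ)                                                  ≤⟨ sum-mono (allFin k) cover ⟩
        sumℚ (allFin k) (λ c → 𝟙 (free? u σ c) + sumℚ (allFin n) (blocked c))       ≡⟨ sum-+ (allFin k) (λ c → 𝟙 (free? u σ c)) (λ c → sumℚ (allFin n) (blocked c)) ⟩
        sumℚ (allFin k) (λ c → 𝟙 (free? u σ c)) + sumℚ (allFin k) (λ c → sumℚ (allFin n) (blocked c))
          ≡⟨ cong₂ _+_ (sym (length-filter (free? u σ) (allFin k))) blocked-total ⟩
        ι (length (free u σ)) + ι (degree G u)                                      ∎

    0<free : ∀ u σ → 0 ℕ.< length (free u σ)
    0<free u σ = ℕ.≤-trans 0<D (free-length u σ)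

    Free-update : ∀ u σ v x c → (Adj u v → c ≢ x) → Free u σ c → Free u (σ [ v ]≔ x) c
    Free-update u σ v x c c≢x fr w uw c≡ with v ≟ w
    ... | yes refl = c≢x uw (trans c≡ (lookup∘update v σ x))
    ... | no v≢w   = fr w uw (trans c≡ (lookup∘update′ (v≢w ∘ sym) σ x))

    Free-update⁻ : ∀ u σ v x c → (Adj u v → c ≢ lookup σ v) → Free u (σ [ v ]≔ x) c → Free u σ c
    Free-update⁻ u σ v x c c≢ fr w uw c≡ with v ≟ w
    ... | yes refl = c≢ uw c≡
    ... | no v≢w   = fr w uw (trans c≡ (sym (lookup∘update′ (v≢w ∘ sym) σ x)))

    free-update : ∀ u σ v x → ¬ Adj u v → free u (σ [ v ]≔ x) ≡ free u σ
    free-update u σ v x ¬uv = filter-≐ (free? u (σ [ v ]≔ x)) (free? u σ)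
      ((λ {c} → Free-update⁻ u σ v x c (⊥-elim ∘ ¬uv)) , (λ {c} → Free-update u σ v x c (⊥-elim ∘ ¬uv))) (allFin k)

    -- At `v = u` the colour is overwritten, and the free list of `u` does not see it. At a
    -- non-neighbour the free list is unchanged and the two recolourings commute. At a neighbour the
    -- free list may gain the old colour of `v` and lose the new one; by `avg-exchange` this costs
    -- `a u / D` on top of `a v`.
    heat-osc : ∀ {f a} → Osc f a → ∀ u →
      Osc (heat u f) (λ v → (a v - 𝟙 (v ≟ u) * a u) + 𝟙 (adj? v u) * (1/ D * a u))
    heat-osc {f} {a} osc u .osc-bound σ v x with v ≟ u
    ... | yes refl = ≤-reflexive (begin
        avg (free u (σ [ u ]≔ x)) (λ c → f (σ [ u ]≔ x [ u ]≔ c))   ≡⟨ cong (λ cs → avg cs (λ c → f (σ [ u ]≔ x [ u ]≔ c))) (free-update u σ u x (no-loop u)) ⟩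
        avg (free u σ) (λ c → f (σ [ u ]≔ x [ u ]≔ c))              ≡⟨ avg-cong (free u σ) (λ c → cong f ([]≔-idempotent σ u)) ⟩
        heat u f σ                                                   ≡⟨ solve 3 (λ h p e → h := h :+ ((p :- con 1ℚ :* p) :+ con 0ℚ :* e)) refl (heat u f σ) (a u) (1/ D * a u) ⟩
        heat u f σ + ((a u - 1ℚ * a u) + 0ℚ * (1/ D * a u))          ≡⟨ cong (λ z → heat u f σ + ((a u - 1ℚ * a u) + z * (1/ D * a u))) (sym (𝟙-no (adj? u u) (no-loop u))) ⟩
        heat u f σ + ((a u - 1ℚ * a u) + 𝟙 (adj? u u) * (1/ D * a u)) ∎)
      where open ≡-Reasoning
    ... | no v≢u with adj? v u
    ...   | no ¬vu = begin
        avg (free u (σ [ v ]≔ x)) (λ c → f (σ [ v ]≔ x [ u ]≔ c))   ≡⟨ cong (λ cs → avg cs (λ c → f (σ [ v ]≔ x [ u ]≔ c))) (free-update u σ v x (¬vu ∘ adj-sym)) ⟩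
        avg (free u σ) (λ c → f (σ [ v ]≔ x [ u ]≔ c))              ≤⟨ avg-mono-∈ (free u σ) (λ {c} _ → commute c) ⟩
        avg (free u σ) (λ c → f (σ [ u ]≔ c) + a v)                 ≡⟨ avg-+const (free u σ) (0<free u σ) (λ c → f (σ [ u ]≔ c)) (a v) ⟩
        heat u f σ + a v                                             ≡⟨ solve 4 (λ h p q e → h :+ p := h :+ ((p :- con 0ℚ :* q) :+ con 0ℚ :* e)) refl (heat u f σ) (a v) (a u) (1/ D * a u) ⟩
        heat u f σ + ((a v - 0ℚ * a u) + 0ℚ * (1/ D * a u))          ∎
      where
      open ≤-Reasoning
      commute : ∀ c → f (σ [ v ]≔ x [ u ]≔ c) ≤ f (σ [ u ]≔ c) + a v
      commute c = subst (λ τ → f τ ≤ f (σ [ u ]≔ c) + a v) ([]≔-commutes σ u v (v≢u ∘ sym)) (osc-bound osc (σ [ u ]≔ c) v x)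
    ...   | yes vu = begin
        avg (free u (σ [ v ]≔ x)) (λ c → f (σ [ v ]≔ x [ u ]≔ c))   ≤⟨ avg-mono-∈ (free u (σ [ v ]≔ x)) (λ {c} _ → commute c) ⟩
        avg (free u (σ [ v ]≔ x)) (λ c → f (σ [ u ]≔ c) + a v)      ≡⟨ avg-+const (free u (σ [ v ]≔ x)) (0<free u (σ [ v ]≔ x)) (λ c → f (σ [ u ]≔ c)) (a v) ⟩
        avg (free u (σ [ v ]≔ x)) (λ c → f (σ [ u ]≔ c)) + a v      ≤⟨ +-monoˡ-≤ (a v) (avg-exchange 0<D (free? u (σ [ v ]≔ x)) (free? u σ)
                                                                          (free-length u (σ [ v ]≔ x)) (free-length u σ) (lookup σ v) x
                                                                          (λ c c≢ → Free-update⁻ u σ v x c (λ _ → c≢))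
                                                                          (λ c c≢ → Free-update u σ v x c (λ _ → c≢))
                                                                          (λ c → f (σ [ u ]≔ c)) (a u) site) ⟩
        (heat u f σ + 1/ D * a u) + a v                              ≡⟨ solve 4 (λ h p q e → (h :+ e) :+ p := h :+ ((p :- con 0ℚ :* q) :+ con 1ℚ :* e)) refl (heat u f σ) (a v) (a u) (1/ D * a u) ⟩
        heat u f σ + ((a v - 0ℚ * a u) + 1ℚ * (1/ D * a u))          ∎
      where
      open ≤-Reasoning
      commute : ∀ c → f (σ [ v ]≔ x [ u ]≔ c) ≤ f (σ [ u ]≔ c) + a v
      commute c = subst (λ τ → f τ ≤ f (σ [ u ]≔ c) + a v) ([]≔-commutes σ u v (v≢u ∘ sym)) (osc-bound osc (σ [ u ]≔ c) v x)
      site : ∀ c c′ → f (σ [ u ]≔ c) ≤ f (σ [ u ]≔ c′) + a u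
      site c c′ = subst (λ τ → f τ ≤ f (σ [ u ]≔ c′) + a u) ([]≔-idempotent σ u) (osc-bound osc (σ [ u ]≔ c′) u c)

  -- The Archimedean property

  ι-above : ∀ p → ∃[ m ] p ≤ ι m
  ι-above p@(mkℚ (ℤ.+ a) d c) = a , toℚᵘ-cancel-≤ (ℚᵘ.≤-trans
    (ℚᵘ.*≤* (ℤ.*-monoˡ-≤-nonNeg (ℤ.+ a) (ℤ.+≤+ (ℕ.s≤s ℕ.z≤n))))
    (ℚᵘ.≤-reflexive (ℚᵘ.≃-sym (toℚᵘ-fromℚᵘ (ℚᵘ.mkℚᵘ (ℤ.+ a) 0)))))
  ι-above (mkℚ ℤ.-[1+ a ] d c) = 0 , *≤* ℤ.-≤+

  -- Along `t = j * q` the multiple `ι t * X` is at least `j`, so `K` would bound every natural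
  -- number.
  unbounded-multiples : ∀ {K X q} → 0 ℕ.< q → 1/ q ≤ X → ¬ (∀ t → ι t * X ≤ K)
  unbounded-multiples {K} {X} {q} 0<q 1/q≤X h with ι-above K
  ... | m , K≤m = ℕ.<-irrefl refl (ι-cancel-≤ {suc m} {m} (reach (suc m)))
    where
    open ≤-Reasoning
    reach : ∀ j → ι j ≤ ι m
    reach j = begin
      ι j                        ≡⟨ sym (*-identityʳ (ι j)) ⟩
      ι j * 1ℚ                   ≡⟨ cong (ι j *_) (sym (1/-* q 0<q)) ⟩
      ι j * (1/ q * ι q)         ≤⟨ *-monoˡ (0≤ι j) (*-monoʳ (0≤ι q) 1/q≤X) ⟩
      ι j * (X * ι q)            ≡⟨ solve 3 (λ p x q → p :* (x :* q) := (p :* q) :* x) refl (ι j) X (ι q) ⟩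
      (ι j * ι q) * X            ≡⟨ cong (_* X) (sym (ι-* j q)) ⟩
      ι (j ℕ.* q) * X            ≤⟨ h (j ℕ.* q) ⟩
      K                          ≤⟨ K≤m ⟩
      ι m                        ∎

  1/denominator-≤ : ∀ a d .(c : Coprime (suc a) (suc d)) → 1/ (suc d) ≤ mkℚ (ℤ.+ suc a) d c
  1/denominator-≤ a d c = toℚᵘ-cancel-≤ (ℚᵘ.≤-trans (ℚᵘ.≤-reflexive (toℚᵘ-fromℚᵘ (ℚᵘ.mkℚᵘ (ℤ.+ 1) d)))
    (ℚᵘ.*≤* (ℤ.*-monoʳ-≤-nonNeg (ℤ.+ suc d) {ℤ.+ 1} {ℤ.+ suc a} (ℤ.+≤+ (ℕ.s≤s ℕ.z≤n)))))

  -- A positive rational is at least one over its denominator, so its multiples are unbounded. This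
  -- stands in for letting the number of Glauber steps tend to infinity.
  archimedean : ∀ K X → (∀ t → ι t * X ≤ K) → X ≤ 0ℚ
  archimedean K (mkℚ (ℤ.+ zero) d c)  h = *≤* ℤ.≤-refl
  archimedean K (mkℚ ℤ.-[1+ a ] d c)  h = *≤* ℤ.-≤+
  archimedean K (mkℚ (ℤ.+ suc a) d c) h = ⊥-elim (unbounded-multiples {K} {mkℚ (ℤ.+ suc a) d c} {suc d} (ℕ.s≤s ℕ.z≤n) (1/denominator-≤ a d c) h)

  -- Enumeration of colourings and resampling of one colour

  inhabited : {A : Set} {xs : List A} → 0 ℕ.< length xs → ∃[ x ] x ∈ˡ xs
  inhabited {xs = x ∷ _} _ = x , here refl

  ∈-allColorings : ∀ {n k} (σ : Coloring n k) → σ ∈ˡ allColorings n k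
  ∈-allColorings []      = here refl
  ∈-allColorings (x ∷ σ) = ∈-cartesianProductWith⁺ _∷_ (∈-allFin x) (∈-allColorings σ)

  -- Resampling the colour at u is an involution on pairs (old colouring, new colour).
  sum-resample : ∀ {n k} (u : Fin n) (H : Coloring n k → Fin k → ℚ) →
    sumℚ (allColorings n k) (λ τ → sumℚ (allFin k) (H τ)) ≡
    sumℚ (allColorings n k) (λ τ → sumℚ (allFin k) (λ c → H (τ [ u ]≔ c) (lookup τ u)))
  sum-resample {suc n} {k} zero H = begin
    sumℚ (allColorings (suc n) k) (λ τ → sumℚ (allFin k) (H τ))
      ≡⟨ sum-allColorings-suc n k (λ τ → sumℚ (allFin k) (H τ)) ⟩
    sumℚ (allFin k) (λ x → sumℚ (allColorings n k) (λ ρ → sumℚ (allFin k) (H (x ∷ ρ))))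
      ≡⟨ sum-cong (allFin k) (λ x → sum-swap (allColorings n k) (allFin k) (λ ρ → H (x ∷ ρ))) ⟩
    sumℚ (allFin k) (λ x → sumℚ (allFin k) (λ c → sumℚ (allColorings n k) (λ ρ → H (x ∷ ρ) c)))
      ≡⟨ sum-swap (allFin k) (allFin k) (λ x c → sumℚ (allColorings n k) (λ ρ → H (x ∷ ρ) c)) ⟩
    sumℚ (allFin k) (λ c → sumℚ (allFin k) (λ x → sumℚ (allColorings n k) (λ ρ → H (x ∷ ρ) c)))
      ≡⟨ sum-cong (allFin k) (λ c → sum-swap (allFin k) (allColorings n k) (λ x ρ → H (x ∷ ρ) c)) ⟩
    sumℚ (allFin k) (λ c → sumℚ (allColorings n k) (λ ρ → sumℚ (allFin k) (λ x → H (x ∷ ρ) c)))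
      ≡⟨ sym (sum-allColorings-suc n k (λ τ → sumℚ (allFin k) (λ c → H (τ [ zero ]≔ c) (lookup τ zero)))) ⟩
    sumℚ (allColorings (suc n) k) (λ τ → sumℚ (allFin k) (λ c → H (τ [ zero ]≔ c) (lookup τ zero))) ∎
    where open ≡-Reasoning
  sum-resample {suc n} {k} (suc u) H = begin
    sumℚ (allColorings (suc n) k) (λ τ → sumℚ (allFin k) (H τ))
      ≡⟨ sum-allColorings-suc n k (λ τ → sumℚ (allFin k) (H τ)) ⟩
    sumℚ (allFin k) (λ x → sumℚ (allColorings n k) (λ ρ → sumℚ (allFin k) (H (x ∷ ρ))))
      ≡⟨ sum-cong (allFin k) (λ x → sum-resample u (λ ρ → H (x ∷ ρ))) ⟩
    sumℚ (allFin k) (λ x → sumℚ (allColorings n k) (λ ρ → sumℚ (allFin k) (λ c → H (x ∷ (ρ [ u ]≔ c)) (lookup ρ u))))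
      ≡⟨ sym (sum-allColorings-suc n k (λ τ → sumℚ (allFin k) (λ c → H (τ [ suc u ]≔ c) (lookup τ (suc u))))) ⟩
    sumℚ (allColorings (suc n) k) (λ τ → sumℚ (allFin k) (λ c → H (τ [ suc u ]≔ c) (lookup τ (suc u)))) ∎
    where open ≡-Reasoning

  -- Block resampling and its invariance under heat bath steps

  module BlockUpdate {n : ℕ} (k D : ℕ) (G : Graph n) (0<D : 0 ℕ.< D) (D-slack : ∀ u → degree G u ℕ.+ D ℕ.≤ k)
    (B : Subset n) where
    open Graph G
    open HeatBath k D G 0<D D-slack

    -- Unlike IsRecoloring, this does not ask edges outside B to be properly coloured,
    -- so that the update makes sense at every colouring, proper or not.
    Resample : Coloring n k → Coloring n k → Set
    Resample σ τ = (∀ u → u ∈ B → Free u τ (lookup τ u)) × AgreeOutside G k B σ τ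

    resample? : ∀ σ τ → Dec (Resample σ τ)
    resample? σ τ = (all? λ u → (u ∈? B) →-dec free? u τ (lookup τ u))
      ×-dec (all? λ v → ¬? (v ∈? B) →-dec (lookup τ v ≟ lookup σ v))

    resamples : Coloring n k → List (Coloring n k)
    resamples σ = filter (resample? σ) (allColorings n k)

    update : (Coloring n k → ℚ) → Coloring n k → ℚ
    update f σ = avg (resamples σ) f

    -- Nothing is asked of the old colour of `u`, which may clash with a neighbour. Freeness of `c`
    -- takes care of every edge at `u`, seen from either end, and the other edges do not change.
    Free-recolor : ∀ {u τ c w} → Free u τ c → (w ≢ u → Free w τ (lookup τ w)) →
      Free w (τ [ u ]≔ c) (lookup (τ [ u ]≔ c) w)
    Free-recolor {u} {τ} {c} {w} fr old v wv eq with w ≟ u | v ≟ u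
    ... | yes refl | yes refl = no-loop u wv
    ... | yes refl | no v≢u   = fr v wv (trans (sym (lookup∘update u τ c)) (trans eq (lookup∘update′ v≢u τ c)))
    ... | no w≢u   | yes refl = fr w (adj-sym wv) (trans (sym (lookup∘update u τ c)) (trans (sym eq) (lookup∘update′ w≢u τ c)))
    ... | no w≢u   | no v≢u   = old w≢u v wv (trans (sym (lookup∘update′ w≢u τ c)) (trans eq (lookup∘update′ v≢u τ c)))

    free-color : ∀ u τ → ∃[ c ] Free u τ c
    free-color u τ with inhabited (0<free u τ)
    ... | c , c∈ = c , proj₂ (∈-filter⁻ (free? u τ) {xs = allFin k} c∈)

    -- A free colour clashes with no neighbour, so vertices treated earlier stay good when the next
    -- one is recoloured. This provides a resampling of every `σ`, proper or not, so that averages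
    -- over `resamples σ` are never averages over an empty list.
    greedy : ∀ (us : List (Fin n)) σ →
      ∃[ τ ] ((∀ {u} → u ∈ˡ us → u ∈ B → Free u τ (lookup τ u)) × AgreeOutside G k B σ τ)
    greedy []       σ = σ , (λ ()) , λ _ _ → refl
    greedy (u ∷ us) σ with greedy us σ | u ∈? B
    ... | τ , fr , agree | no u∉B  = τ , (λ { (here refl) u∈B → ⊥-elim (u∉B u∈B) ; (there w∈) → fr w∈ }) , agree
    ... | τ , fr , agree | yes u∈B = recolored (free-color u τ)
      where
      recolored : ∃[ c ] Free u τ c →
        ∃[ τ′ ] ((∀ {w} → w ∈ˡ u ∷ us → w ∈ B → Free w τ′ (lookup τ′ w)) × AgreeOutside G k B σ τ′)
      recolored (c , c-free) = τ [ u ]≔ c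
        , (λ { (here refl) _ → Free-recolor {u} {τ} {c} c-free (λ u≢u → ⊥-elim (u≢u refl))
             ; (there w∈) w∈B → Free-recolor {u} {τ} {c} c-free (λ _ → fr w∈ w∈B) })
        , (λ v v∉B → trans (lookup∘update′ (λ { refl → v∉B u∈B }) τ c) (agree v v∉B))

    0<resamples : ∀ σ → 0 ℕ.< length (resamples σ)
    0<resamples σ with greedy (allFin n) σ
    ... | τ , fr , agree = ∈-length (∈-filter⁺ (resample? σ) (∈-allColorings τ) ((λ u → fr (∈-allFin u)) , agree))

    Resample-recolor : ∀ σ τ {u} c → u ∈ B → Free u τ c → Resample σ τ → Resample σ (τ [ u ]≔ c)
    Resample-recolor σ τ {u} c u∈B fr (proper , agree) =
      (λ w w∈B → Free-recolor {u} {τ} {c} fr (λ _ → proper w w∈B)) ,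
      (λ v v∉B → trans (lookup∘update′ (λ { refl → v∉B u∈B }) τ c) (agree v v∉B))

    Free-own⁺ : ∀ u τ c {d} → Free u τ d → Free u (τ [ u ]≔ c) d
    Free-own⁺ u τ c {d} = Free-update u τ u c d (⊥-elim ∘ no-loop u)

    Free-own⁻ : ∀ u τ c {d} → Free u (τ [ u ]≔ c) d → Free u τ d
    Free-own⁻ u τ c {d} = Free-update⁻ u τ u c d (⊥-elim ∘ no-loop u)

    -- Putting the old colour of `u` back undoes the recolouring; it is still free, because the free
    -- colours at `u` do not depend on the colour of `u`.
    reversible : ∀ σ τ {u} c → u ∈ B → Resample σ (τ [ u ]≔ c) → Free u τ (lookup τ u) → Resample σ τ × Free u τ c
    reversible σ τ {u} c u∈B res fr =
      subst (Resample σ) (trans ([]≔-idempotent τ u) ([]≔-lookup τ u)) (Resample-recolor σ (τ [ u ]≔ c) (lookup τ u) u∈B (Free-own⁺ u τ c fr) res) ,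
      Free-own⁻ u τ c (subst (Free u (τ [ u ]≔ c)) (lookup∘update u τ c) (proj₁ res u u∈B))

    -- Reversibility: the move from `τ` to `τ [ u ]≔ c` has weight `1/ (length (free u τ))`, and the
    -- free list is the same at both ends. Exchanging `c` with the old colour by `sum-resample`
    -- frees `f` from the inner sum, and the remaining weights over `c` add up to one.
    sum-heat : ∀ σ {u} → u ∈ B → ∀ f → sumℚ (resamples σ) (heat u f) ≡ sumℚ (resamples σ) f
    sum-heat σ {u} u∈B f = begin
      sumℚ (resamples σ) (heat u f)
        ≡⟨ sum-filter (resample? σ) cols (heat u f) ⟩
      sumℚ cols (λ τ → R τ * heat u f τ)
        ≡⟨ sum-cong cols expand ⟩
      sumℚ cols (λ τ → sumℚ (allFin k) (H τ))
        ≡⟨ sum-resample u H ⟩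
      sumℚ cols (λ τ → sumℚ (allFin k) (λ c → H (τ [ u ]≔ c) (lookup τ u)))
        ≡⟨ sum-cong cols (λ τ → trans (sum-cong (allFin k) (swap τ)) (collect τ)) ⟩
      sumℚ cols (λ τ → R τ * f τ)
        ≡⟨ sym (sum-filter (resample? σ) cols f) ⟩
      sumℚ (resamples σ) f ∎
      where
      open ≡-Reasoning
      cols = allColorings n k
      R : Coloring n k → ℚ
      R τ = 𝟙 (resample? σ τ)
      q : Coloring n k → ℚ
      q τ = 1/ (length (free u τ))
      H : Coloring n k → Fin k → ℚ
      H τ c = R τ * (q τ * (𝟙 (free? u τ c) * f (τ [ u ]≔ c)))
      expand : ∀ τ → R τ * heat u f τ ≡ sumℚ (allFin k) (H τ)
      expand τ = sym (trans (sum-*ˡ (allFin k) (R τ) (λ c → q τ * (𝟙 (free? u τ c) * f (τ [ u ]≔ c))))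
        (cong (R τ *_) (trans (sum-*ˡ (allFin k) (q τ) (λ c → 𝟙 (free? u τ c) * f (τ [ u ]≔ c)))
          (cong (q τ *_) (sym (sum-filter (free? u τ) (allFin k) (λ c → f (τ [ u ]≔ c))))))))
      indicators : ∀ τ c → R (τ [ u ]≔ c) * 𝟙 (free? u (τ [ u ]≔ c) (lookup τ u)) ≡ R τ * 𝟙 (free? u τ c)
      indicators τ c = trans (sym (𝟙-× (resample? σ (τ [ u ]≔ c)) (free? u (τ [ u ]≔ c) (lookup τ u))))
        (trans (𝟙-cong (resample? σ (τ [ u ]≔ c) ×-dec free? u (τ [ u ]≔ c) (lookup τ u)) (resample? σ τ ×-dec free? u τ c)
                 (λ (res , fr) → reversible σ τ c u∈B res (Free-own⁻ u τ c fr))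
                 (λ (res , fr) → Resample-recolor σ τ c u∈B fr res , Free-own⁺ u τ c (proj₁ res u u∈B)))
          (𝟙-× (resample? σ τ) (free? u τ c)))
      swap : ∀ τ c → H (τ [ u ]≔ c) (lookup τ u) ≡ (R τ * (q τ * f τ)) * 𝟙 (free? u τ c)
      swap τ c = begin
        R τ′ * (q τ′ * (𝟙 (free? u τ′ (lookup τ u)) * f (τ′ [ u ]≔ lookup τ u)))
          ≡⟨ cong₂ (λ cs ρ → R τ′ * (1/ (length cs) * (𝟙 (free? u τ′ (lookup τ u)) * f ρ)))
               (free-update u τ u c (no-loop u)) (trans ([]≔-idempotent τ u) ([]≔-lookup τ u)) ⟩
        R τ′ * (q τ * (𝟙 (free? u τ′ (lookup τ u)) * f τ))
          ≡⟨ solve 4 (λ a b c d → a :* (b :* (c :* d)) := (a :* c) :* (b :* d)) refl (R τ′) (q τ) (𝟙 (free? u τ′ (lookup τ u))) (f τ) ⟩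
        (R τ′ * 𝟙 (free? u τ′ (lookup τ u))) * (q τ * f τ)
          ≡⟨ cong (_* (q τ * f τ)) (indicators τ c) ⟩
        (R τ * 𝟙 (free? u τ c)) * (q τ * f τ)
          ≡⟨ solve 3 (λ a b c → (a :* b) :* c := (a :* c) :* b) refl (R τ) (𝟙 (free? u τ c)) (q τ * f τ) ⟩
        (R τ * (q τ * f τ)) * 𝟙 (free? u τ c) ∎
        where τ′ = τ [ u ]≔ c
      collect : ∀ τ → sumℚ (allFin k) (λ c → (R τ * (q τ * f τ)) * 𝟙 (free? u τ c)) ≡ R τ * f τ
      collect τ = begin
        sumℚ (allFin k) (λ c → (R τ * (q τ * f τ)) * 𝟙 (free? u τ c))
          ≡⟨ sum-*ˡ (allFin k) (R τ * (q τ * f τ)) (λ c → 𝟙 (free? u τ c)) ⟩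
        (R τ * (q τ * f τ)) * sumℚ (allFin k) (λ c → 𝟙 (free? u τ c))
          ≡⟨ cong ((R τ * (q τ * f τ)) *_) (sym (length-filter (free? u τ) (allFin k))) ⟩
        (R τ * (q τ * f τ)) * ι (length (free u τ))
          ≡⟨ solve 4 (λ a b c d → (a :* (b :* c)) :* d := (a :* c) :* (b :* d)) refl (R τ) (q τ) (f τ) (ι (length (free u τ))) ⟩
        (R τ * f τ) * (q τ * ι (length (free u τ)))
          ≡⟨ cong ((R τ * f τ) *_) (1/-* (length (free u τ)) (0<free u τ)) ⟩
        (R τ * f τ) * 1ℚ
          ≡⟨ *-identityʳ (R τ * f τ) ⟩
        R τ * f τ ∎

  osc-mono : ∀ {n k} {f : Coloring n k → ℚ} {a b} → Osc f a → (∀ v → a v ≤ b v) → Osc f b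
  osc-mono {f = f} osc a≤b .osc-bound σ v x = ≤-trans (osc-bound osc σ v x) (+-monoʳ-≤ (f σ) (a≤b v))

  -- Dobrushin comparison inside one block

  module Comparison {n : ℕ} (k D : ℕ) (G : Graph n) (0<D : 0 ℕ.< D) (D-slack : ∀ u → degree G u ℕ.+ D ℕ.≤ k)
    (B : Subset n) where
    open Graph G
    open HeatBath k D G 0<D D-slack
    open BlockUpdate k D G 0<D D-slack B

    inB : Fin n → ℚ
    inB u = 𝟙 (u ∈? B)

    neighborSum : (Fin n → ℚ) → Fin n → ℚ
    neighborSum c v = sumℚ (allFin n) (λ u → 𝟙 (adj? v u) * c u)

    innerDegree : Fin n → ℚ
    innerDegree = neighborSum inB

    -- Vertices outside `B` may be picked but stay idle, so that `glauber` is an average over all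
    -- `n` vertices.
    localHeat : Fin n → (Coloring n k → ℚ) → Coloring n k → ℚ
    localHeat u f σ = if does (u ∈? B) then heat u f σ else f σ

    glauber : (Coloring n k → ℚ) → Coloring n k → ℚ
    glauber f σ = avg (allFin n) (λ u → localHeat u f σ)

    localHeat-osc : ∀ {f a} → Osc f a → ∀ u →
      Osc (localHeat u f) (λ v → (a v - 𝟙 (v ≟ u) * (inB u * a u)) + 𝟙 (adj? v u) * (1/ D * (inB u * a u)))
    localHeat-osc {f} {a} osc u .osc-bound σ v x with u ∈? B
    ... | yes _ = subst (λ z → heat u f (σ [ v ]≔ x) ≤ heat u f σ + ((a v - 𝟙 (v ≟ u) * z) + 𝟙 (adj? v u) * (1/ D * z)))
      (sym (*-identityˡ (a u))) (osc-bound (heat-osc osc u) σ v x)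
    ... | no _ = ≤-trans (osc-bound osc σ v x) (≤-reflexive
      (solve 6 (λ h p i j d q → h :+ p := h :+ ((p :- i :* (con 0ℚ :* q)) :+ j :* (d :* (con 0ℚ :* q)))) refl
        (f σ) (a v) (𝟙 (v ≟ u)) (𝟙 (adj? v u)) (1/ D) (a u)))

    length-allFin : length (allFin n) ≡ n
    length-allFin = length-tabulate (λ u → u)

    -- `e u` is the mean oscillation that one step takes away from `u`: averaging `localHeat-osc`
    -- over `u` collapses the removal term to `e v`, and each neighbour of `u` receives `e u / D`.
    glauber-osc : 0 ℕ.< n → ∀ {f a} → Osc f a → let e = λ u → 1/ n * (inB u * a u) in
      Osc (glauber f) (λ v → (a v - e v) + 1/ D * neighborSum e v)
    glauber-osc 0<n {f} {a} osc .osc-bound σ v x = begin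
      avg us (λ u → localHeat u f (σ [ v ]≔ x))                 ≤⟨ avg-mono-∈ us (λ {u} _ → osc-bound (localHeat-osc osc u) σ v x) ⟩
      avg us (λ u → localHeat u f σ + ((a v - X u) + Y u))      ≡⟨ avg-+ us (λ u → localHeat u f σ) (λ u → (a v - X u) + Y u) ⟩
      glauber f σ + avg us (λ u → (a v - X u) + Y u)            ≡⟨ cong (glauber f σ +_) avg-gain ⟩
      glauber f σ + ((a v - e v) + 1/ D * neighborSum e v)      ∎
      where
      open ≤-Reasoning
      us = allFin n
      0<us : 0 ℕ.< length us
      0<us = subst (0 ℕ.<_) (sym length-allFin) 0<n
      e X Y : Fin n → ℚ
      e u = 1/ n * (inB u * a u)
      X u = 𝟙 (v ≟ u) * (inB u * a u)
      Y u = 𝟙 (adj? v u) * (1/ D * (inB u * a u))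
      avg-gain : avg us (λ u → (a v - X u) + Y u) ≡ (a v - e v) + 1/ D * neighborSum e v
      avg-gain = begin-equality
        1/ m * sumℚ us (λ u → (a v - X u) + Y u)
          ≡⟨ cong (1/ m *_) (trans (sum-+ us (λ u → a v - X u) Y) (cong (_+ sumℚ us Y) (sum-- us (λ _ → a v) X))) ⟩
        1/ m * ((sumℚ us (λ _ → a v) - sumℚ us X) + sumℚ us Y)
          ≡⟨ solve 4 (λ r p q s → r :* ((p :- q) :+ s) := (r :* p :- r :* q) :+ r :* s) refl (1/ m) (sumℚ us (λ _ → a v)) (sumℚ us X) (sumℚ us Y) ⟩
        (avg us (λ _ → a v) - 1/ m * sumℚ us X) + 1/ m * sumℚ us Y
          ≡⟨ cong₂ _+_ (cong₂ _-_ (avg-const us 0<us (a v)) (cong₂ _*_ (cong 1/ length-allFin) (sum-δ v (λ u → inB u * a u)))) (trans (cong (λ l → 1/ l * sumℚ us Y) length-allFin) gain) ⟩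
        (a v - e v) + 1/ D * neighborSum e v ∎
        where
        m = length us
        gain : 1/ n * sumℚ us Y ≡ 1/ D * neighborSum e v
        gain = trans (sym (sum-*ˡ us (1/ n) Y)) (trans (sum-cong us (λ u →
          solve 4 (λ r j d q → r :* (j :* (d :* q)) := d :* (j :* (r :* q))) refl (1/ n) (𝟙 (adj? v u)) (1/ D) (inB u * a u)))
          (sum-*ˡ us (1/ D) (λ u → 𝟙 (adj? v u) * e u)))

    sum-localHeat : ∀ σ u f → sumℚ (resamples σ) (localHeat u f) ≡ sumℚ (resamples σ) f
    sum-localHeat σ u f with u ∈? B
    ... | yes u∈B = sum-heat σ u∈B f
    ... | no  _   = refl

    update-glauber : 0 ℕ.< n → ∀ f σ → update (glauber f) σ ≡ update f σ
    update-glauber 0<n f σ = cong (1/ (length (resamples σ)) *_) (begin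
      sumℚ rs (λ τ → 1/ m * sumℚ us (λ u → localHeat u f τ))     ≡⟨ sum-*ˡ rs (1/ m) (λ τ → sumℚ us (λ u → localHeat u f τ)) ⟩
      1/ m * sumℚ rs (λ τ → sumℚ us (λ u → localHeat u f τ))     ≡⟨ cong (1/ m *_) (sum-swap rs us (λ τ u → localHeat u f τ)) ⟩
      1/ m * sumℚ us (λ u → sumℚ rs (localHeat u f))             ≡⟨ cong (1/ m *_) (sum-cong us (λ u → sum-localHeat σ u f)) ⟩
      avg us (λ _ → sumℚ rs f)                                   ≡⟨ avg-const us (subst (0 ℕ.<_) (sym length-allFin) 0<n) (sumℚ rs f) ⟩
      sumℚ rs f                                                  ∎)
      where
      open ≡-Reasoning
      rs = resamples σ
      us = allFin n
      m = length us

    update-inside : ∀ f σ {v} x → v ∈ B → update f (σ [ v ]≔ x) ≡ update f σ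
    update-inside f σ {v} x v∈B = cong (λ rs → avg rs f) (filter-≐ (resample? (σ [ v ]≔ x)) (resample? σ)
      ((λ (pr , ag) → pr , λ w w∉B → trans (ag w w∉B) (same w∉B)) ,
       (λ (pr , ag) → pr , λ w w∉B → trans (ag w w∉B) (sym (same w∉B)))) (allColorings n k))
      where
      same : ∀ {w} → w ∉ B → lookup (σ [ v ]≔ x) w ≡ lookup σ w
      same w∉B = lookup∘update′ (λ { refl → w∉B v∈B }) σ x

    -- A resampling of `σ` and one of the changed `σ` differ at most at `v` and inside `B`, so any
    -- pair of them will do. All of `B` is charged, so the bound becomes sharp only once little
    -- oscillation is left inside `B`.
    update-change-≤ : ∀ {g a} → Osc g a → ∀ σ v x →
      update g (σ [ v ]≔ x) ≤ update g σ + (a v + sumℚ (allFin n) (λ u → inB u * a u))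
    update-change-≤ {g} {a} osc σ v x = avg-cross (resamples (σ [ v ]≔ x)) (resamples σ) (0<resamples (σ [ v ]≔ x)) (0<resamples σ)
      (λ {τ′} {τ} τ′∈ τ∈ → subst (λ z → g τ′ ≤ g τ + z) b-total
        (osc-total {a = a} {b = b} osc b-nonneg τ τ′
          (differ τ τ′ (proj₂ (proj₂ (∈-filter⁻ (resample? (σ [ v ]≔ x)) {xs = allColorings n k} τ′∈)))
                  (proj₂ (proj₂ (∈-filter⁻ (resample? σ) {xs = allColorings n k} τ∈))))))
      where
      0≤a : ∀ u → 0ℚ ≤ a u
      0≤a = osc-nonneg osc σ
      b : Fin n → ℚ
      b u = 𝟙 (v ≟ u) * a u + inB u * a u
      b-nonneg : ∀ u → 0ℚ ≤ b u
      b-nonneg u = +-nonneg (*-nonneg (𝟙-nonneg (v ≟ u)) (0≤a u)) (*-nonneg (𝟙-nonneg (u ∈? B)) (0≤a u))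
      b-total : sumℚ (allFin n) b ≡ a v + sumℚ (allFin n) (λ u → inB u * a u)
      b-total = trans (sum-+ (allFin n) (λ u → 𝟙 (v ≟ u) * a u) (λ u → inB u * a u))
        (cong (_+ sumℚ (allFin n) (λ u → inB u * a u)) (sum-δ v a))
      differ : ∀ τ τ′ → AgreeOutside G k B (σ [ v ]≔ x) τ′ → AgreeOutside G k B σ τ →
        ∀ u → lookup τ u ≡ lookup τ′ u ⊎ a u ≤ b u
      differ τ τ′ ag′ ag u with v ≟ u | u ∈? B
      ... | yes refl | d = inj₂ (≤-diff (*-nonneg (𝟙-nonneg d) (0≤a u)) (cong (_+ 𝟙 d * a u) (*-identityˡ (a u))))
      ... | no v≢u | yes _ = inj₂ (≤-reflexive (solve 1 (λ p → p := con 0ℚ :* p :+ con 1ℚ :* p) refl (a u)))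
      ... | no v≢u | no u∉B = inj₁ (trans (ag u u∉B) (trans (sym (lookup∘update′ (v≢u ∘ sym) σ x)) (sym (ag′ u u∉B))))

    -- The oscillations of f are pushed out of B by repeated Glauber steps inside B, which
    -- update does not see: fired t u is the total oscillation taken away from u so far.
    -- The weights make fired t bounded, so the remaining oscillation inside B is summable.
    module Iteration (0<n : 0 ℕ.< n) {f : Coloring n k → ℚ} {L : ℚ} {w : Fin n → ℚ} (0≤L : 0ℚ ≤ L)
      (w-bound : ∀ u → u ∈ B → w u + innerDegree u ≤ ι D) (osc : Osc f (λ v → L * w v)) (σ : Coloring n k) where

      -- The balance of one vertex: its initial oscillation, plus `1 / D` of what its neighbours
      -- have fired, minus what it has fired itself. Only the totals `c` enter, not the order of
      -- firing.
      residue : (Fin n → ℚ) → Fin n → ℚ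
      residue c v = (L * w v + 1/ D * neighborSum c v) - c v

      fired : ℕ → Fin n → ℚ
      fired zero    u = 0ℚ
      fired (suc t) u = fired t u + 1/ n * (inB u * residue (fired t) u)

      iterate : ℕ → Coloring n k → ℚ
      iterate zero    = f
      iterate (suc t) = glauber (iterate t)

      iterate-osc : ∀ t → Osc (iterate t) (residue (fired t))
      iterate-osc zero = osc-mono osc (λ v → ≤-reflexive (begin
        L * w v                                              ≡⟨ solve 2 (λ p d → p := (p :+ d :* con 0ℚ) :- con 0ℚ) refl (L * w v) (1/ D) ⟩
        (L * w v + 1/ D * 0ℚ) - 0ℚ                           ≡⟨ cong (λ z → (L * w v + 1/ D * z) - 0ℚ) (sym (trans (sum-cong (allFin n) (λ u → *-zeroʳ (𝟙 (adj? v u)))) (sum-zero (allFin n)))) ⟩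
        residue (fired 0) v                                  ∎))
        where open ≡-Reasoning
      iterate-osc (suc t) = osc-mono (glauber-osc 0<n (iterate-osc t)) (λ v → ≤-reflexive (begin
        (residue c v - e v) + 1/ D * neighborSum e v         ≡⟨ solve 6 (λ p d s c e s′ → (((p :+ d :* s) :- c) :- e) :+ d :* s′ := (p :+ d :* (s :+ s′)) :- (c :+ e)) refl
                                                                  (L * w v) (1/ D) (neighborSum c v) (c v) (e v) (neighborSum e v) ⟩
        (L * w v + 1/ D * (neighborSum c v + neighborSum e v)) - (c v + e v)
                                                             ≡⟨ cong (λ z → (L * w v + 1/ D * z) - (c v + e v)) (sym (trans (sum-cong (allFin n) (λ u → *-distribˡ-+ (𝟙 (adj? v u)) (c u) (e u)))
                                                                  (sum-+ (allFin n) (λ u → 𝟙 (adj? v u) * c u) (λ u → 𝟙 (adj? v u) * e u)))) ⟩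
        residue (fired (suc t)) v                            ∎))
        where
        open ≡-Reasoning
        c e : Fin n → ℚ
        c = fired t
        e u = 1/ n * (inB u * residue c u)

      -- The recursion is not unfolded: a bound on an oscillation is never negative.
      residue-nonneg : ∀ t u → 0ℚ ≤ residue (fired t) u
      residue-nonneg t = osc-nonneg (iterate-osc t) σ

      fired-outside : ∀ t {u} → u ∉ B → fired t u ≡ 0ℚ
      fired-outside zero    u∉B = refl
      fired-outside (suc t) {u} u∉B = begin
        fired t u + 1/ n * (inB u * residue (fired t) u)     ≡⟨ cong₂ (λ y z → y + 1/ n * (z * residue (fired t) u)) (fired-outside t u∉B) (𝟙-no (u ∈? B) u∉B) ⟩
        0ℚ + 1/ n * (0ℚ * residue (fired t) u)               ≡⟨ solve 2 (λ r p → con 0ℚ :+ r :* (con 0ℚ :* p) := con 0ℚ) refl (1/ n) (residue (fired t) u) ⟩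
        0ℚ                                                   ∎
        where open ≡-Reasoning

      neighborSum-≤ : ∀ {c} → (∀ u → c u ≤ inB u * (L * ι D)) → ∀ v → 1/ D * neighborSum c v ≤ L * innerDegree v
      neighborSum-≤ {c} c≤ v = begin
        1/ D * neighborSum c v                               ≤⟨ *-monoˡ (0≤1/ D) (sum-mono (allFin n) (λ u → *-monoˡ (𝟙-nonneg (adj? v u)) (c≤ u))) ⟩
        1/ D * sumℚ (allFin n) (λ u → 𝟙 (adj? v u) * (inB u * (L * ι D)))
                                                             ≡⟨ cong (1/ D *_) (trans (sum-cong (allFin n) (λ u → sym (*-assoc (𝟙 (adj? v u)) (inB u) (L * ι D)))) (sum-*ʳ (allFin n) (L * ι D) (λ u → 𝟙 (adj? v u) * inB u))) ⟩
        1/ D * (innerDegree v * (L * ι D))                   ≡⟨ solve 4 (λ r i l d → r :* (i :* (l :* d)) := (r :* d) :* (l :* i)) refl (1/ D) (innerDegree v) L (ι D) ⟩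
        (1/ D * ι D) * (L * innerDegree v)                   ≡⟨ trans (cong (_* (L * innerDegree v)) (1/-* D 0<D)) (*-identityˡ (L * innerDegree v)) ⟩
        L * innerDegree v                                    ∎
        where open ≤-Reasoning

      -- Since `1 / n ≤ 1`, a step fires at most the whole residue, so the new total at `u` is at
      -- most `L * w u` plus what has been received so far. By induction each neighbour in `B` has
      -- fired at most `L * D`, hence has handed over at most `L`.
      fired-≤ : ∀ t u → fired t u ≤ inB u * (L * ι D)
      fired-≤ zero    u = *-nonneg (𝟙-nonneg (u ∈? B)) (*-nonneg 0≤L (0≤ι D))
      fired-≤ (suc t) u with u ∈? B
      ... | no u∉B = ≤-reflexive (trans (trans (solve 3 (λ c r p → c :+ r :* (con 0ℚ :* p) := c) refl (fired t u) (1/ n) (residue (fired t) u)) (fired-outside t u∉B)) (sym (*-zeroˡ (L * ι D))))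
      ... | yes u∈B = begin
        fired t u + 1/ n * (1ℚ * residue (fired t) u)        ≤⟨ +-monoʳ-≤ (fired t u) (*-monoʳ (*-nonneg 0≤1 (residue-nonneg t u)) (1/-antimono {1} ℕ.≤-refl 0<n)) ⟩
        fired t u + 1ℚ * (1ℚ * residue (fired t) u)          ≡⟨ solve 2 (λ c p → c :+ con 1ℚ :* (con 1ℚ :* (p :- c)) := p) refl (fired t u) (L * w u + 1/ D * neighborSum (fired t) u) ⟩
        L * w u + 1/ D * neighborSum (fired t) u             ≤⟨ +-monoʳ-≤ (L * w u) (neighborSum-≤ (fired-≤ t) u) ⟩
        L * w u + L * innerDegree u                          ≡⟨ sym (*-distribˡ-+ L (w u) (innerDegree u)) ⟩
        L * (w u + innerDegree u)                            ≤⟨ *-monoˡ 0≤L (w-bound u u∈B) ⟩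
        L * ι D                                              ≡⟨ sym (*-identityˡ (L * ι D)) ⟩
        1ℚ * (L * ι D)                                       ∎
        where open ≤-Reasoning

      update-iterate : ∀ t ρ → update (iterate t) ρ ≡ update f ρ
      update-iterate zero    ρ = refl
      update-iterate (suc t) ρ = trans (update-glauber 0<n (iterate t) ρ) (update-iterate t ρ)

      -- `X` is the excess over the claimed bound. As `update` cannot tell the iterates from `f`, at
      -- every stage the residue inside `B` is at least `X`. Each step fires a share `1 / n` of that
      -- residue while the total fired stays bounded, so `X ≤ 0`.
      update-outside : ∀ v x → v ∉ B → update f (σ [ v ]≔ x) ≤ update f σ + L * (w v + innerDegree v)
      update-outside v x v∉B = ≤-diff (≤-trans (≤-reflexive (sym (+-inverseʳ 0ℚ))) (diff-nonneg (archimedean K X partial-sums)))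
        (solve 2 (λ p q → q := p :+ (con 0ℚ :- (p :- q))) refl (update f (σ [ v ]≔ x)) bound)
        where
        open ≤-Reasoning
        bound X K : ℚ
        bound = update f σ + L * (w v + innerDegree v)
        X = update f (σ [ v ]≔ x) - bound
        K = ι n * sumℚ (allFin n) (λ u → inB u * (L * ι D))
        inner : ℕ → ℚ
        inner t = sumℚ (allFin n) (λ u → inB u * residue (fired t) u)
        residue-v : ∀ t → residue (fired t) v ≤ L * (w v + innerDegree v)
        residue-v t = begin
          (L * w v + 1/ D * neighborSum (fired t) v) - fired t v   ≡⟨ cong (λ z → (L * w v + 1/ D * neighborSum (fired t) v) - z) (fired-outside t v∉B) ⟩
          (L * w v + 1/ D * neighborSum (fired t) v) - 0ℚ          ≡⟨ +-identityʳ (L * w v + 1/ D * neighborSum (fired t) v) ⟩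
          L * w v + 1/ D * neighborSum (fired t) v                 ≤⟨ +-monoʳ-≤ (L * w v) (neighborSum-≤ (fired-≤ t) v) ⟩
          L * w v + L * innerDegree v                              ≡⟨ sym (*-distribˡ-+ L (w v) (innerDegree v)) ⟩
          L * (w v + innerDegree v)                                ∎
        X≤inner : ∀ t → X ≤ inner t
        X≤inner t = begin
          update f (σ [ v ]≔ x) - bound                            ≡⟨ cong (_- bound) (sym (update-iterate t (σ [ v ]≔ x))) ⟩
          update (iterate t) (σ [ v ]≔ x) - bound                  ≤⟨ +-monoˡ-≤ (- bound) (update-change-≤ (iterate-osc t) σ v x) ⟩
          (update (iterate t) σ + (residue (fired t) v + inner t)) - bound
                                                                   ≤⟨ +-monoˡ-≤ (- bound) (+-mono-≤ (≤-reflexive (update-iterate t σ)) (+-monoˡ-≤ (inner t) (residue-v t))) ⟩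
          (update f σ + (L * (w v + innerDegree v) + inner t)) - bound
                                                                   ≡⟨ solve 3 (λ p q r → (p :+ (q :+ r)) :- (p :+ q) := r) refl (update f σ) (L * (w v + innerDegree v)) (inner t) ⟩
          inner t                                                  ∎
        accumulated : ∀ t → ι t * X ≤ ι n * sumℚ (allFin n) (fired t)
        accumulated zero = ≤-reflexive (trans (*-zeroˡ X) (sym (trans (cong (ι n *_) (sum-zero (allFin n))) (*-zeroʳ (ι n)))))
        accumulated (suc t) = begin
          ι (suc t) * X                                            ≡⟨ trans (cong (_* X) (ι-suc t)) (solve 2 (λ s y → (con 1ℚ :+ s) :* y := s :* y :+ y) refl (ι t) X) ⟩
          ι t * X + X                                              ≤⟨ +-mono-≤ (accumulated t) (X≤inner t) ⟩
          ι n * S + inner t                                        ≡⟨ cong (ι n * S +_) (sym (trans (cong (_* inner t) (1/-* n 0<n)) (*-identityˡ (inner t)))) ⟩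
          ι n * S + (1/ n * ι n) * inner t                         ≡⟨ solve 4 (λ m s r i → m :* s :+ (r :* m) :* i := m :* (s :+ r :* i)) refl (ι n) S (1/ n) (inner t) ⟩
          ι n * (S + 1/ n * inner t)                               ≡⟨ cong (λ z → ι n * (S + z)) (sym (sum-*ˡ (allFin n) (1/ n) (λ u → inB u * residue (fired t) u))) ⟩
          ι n * (S + sumℚ (allFin n) (λ u → 1/ n * (inB u * residue (fired t) u)))
                                                                   ≡⟨ cong (ι n *_) (sym (sum-+ (allFin n) (fired t) (λ u → 1/ n * (inB u * residue (fired t) u)))) ⟩
          ι n * sumℚ (allFin n) (fired (suc t))                    ∎
          where
          S = sumℚ (allFin n) (fired t)
        partial-sums : ∀ t → ι t * X ≤ K
        partial-sums t = ≤-trans (accumulated t) (*-monoˡ (0≤ι n) (sum-mono (allFin n) (fired-≤ t)))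

    -- The subtracted term makes the bound vanish for `v ∈ B`, where the colour is overwritten; in
    -- this indicator form it can be summed over the blocks.
    update-osc : ∀ {f L w} → 0ℚ ≤ L → (∀ u → u ∈ B → w u + innerDegree u ≤ ι D) → Osc f (λ v → L * w v) →
      Osc (update f) (λ v → L * (w v + innerDegree v) - inB v * (L * (w v + innerDegree v)))
    update-osc {f} {L} {w} 0≤L w-bound osc .osc-bound σ v x with v ∈? B
    ... | yes v∈B = ≤-reflexive (trans (update-inside f σ x v∈B)
      (solve 2 (λ p q → p := p :+ (q :- con 1ℚ :* q)) refl (update f σ) (L * (w v + innerDegree v))))
    ... | no v∉B = ≤-trans (Iteration.update-outside (0<n v) {w = w} 0≤L w-bound osc σ v x v∉B)
      (≤-reflexive (solve 2 (λ p q → p :+ q := p :+ (q :- con 0ℚ :* q)) refl (update f σ) (L * (w v + innerDegree v))))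
      where
      0<n : ∀ {m} → Fin m → 0 ℕ.< m
      0<n zero    = ℕ.s≤s ℕ.z≤n
      0<n (suc _) = ℕ.s≤s ℕ.z≤n

  -- Powers and signs

  pow : ℚ → ℕ → ℚ
  pow x zero    = 1ℚ
  pow x (suc m) = x * pow x m

  pow-nonneg : ∀ {x} → 0ℚ ≤ x → ∀ m → 0ℚ ≤ pow x m
  pow-nonneg 0≤x zero    = 0≤1
  pow-nonneg 0≤x (suc m) = *-nonneg 0≤x (pow-nonneg 0≤x m)

  signᵈ : {P : Set} → Dec P → ℚ
  signᵈ (yes _) = 1ℚ
  signᵈ (no _)  = - 1ℚ

  signᵈ-≤1 : {P : Set} (d : Dec P) → signᵈ d ≤ 1ℚ
  signᵈ-≤1 (yes _) = ≤-refl
  signᵈ-≤1 (no _)  = ≤-trans (neg-antimono-≤ 0≤1) 0≤1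

  signᵈ-≥-1 : {P : Set} (d : Dec P) → - 1ℚ ≤ signᵈ d
  signᵈ-≥-1 (yes _) = ≤-trans (neg-antimono-≤ 0≤1) 0≤1
  signᵈ-≥-1 (no _)  = ≤-refl

  ∣p∣≡p*signᵈ : ∀ p (d : Dec (0ℚ ≤ p)) → ∣ p ∣ ≡ p * signᵈ d
  ∣p∣≡p*signᵈ p (yes 0≤p) = trans (0≤p⇒∣p∣≡p 0≤p) (sym (*-identityʳ p))
  ∣p∣≡p*signᵈ p (no 0≰p)  = trans (sym (∣-p∣≡∣p∣ p)) (trans (0≤p⇒∣p∣≡p (neg-antimono-≤ (<⇒≤ (≰⇒> 0≰p))))
    (solve 1 (λ p → :- p := p :* con (- 1ℚ)) refl p))

  sign : ℚ → ℚ
  sign p = signᵈ (0ℚ ≤? p)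

  sign-≤ : ∀ p q → sign p ≤ sign q + (1ℚ + 1ℚ)
  sign-≤ p q = ≤-trans (signᵈ-≤1 (0ℚ ≤? p)) (+-monoˡ-≤ (1ℚ + 1ℚ) (signᵈ-≥-1 (0ℚ ≤? q)))

  -- Contraction under one step of the block dynamics

  module BlockDynamics {n N : ℕ} (k D : ℕ) (G : Graph n) (D-slack : ∀ u → degree G u ℕ.+ D ℕ.≤ k)
    (degree<D : ∀ u → degree G u ℕ.< D) (0<D : 0 ℕ.< D) (0<N : 0 ℕ.< N)
    (B : Fin N → Subset n) (partition : IsPartition B) where
    open Graph G
    open IsPartition partition
    private
      module U (i : Fin N) = BlockUpdate k D G 0<D D-slack (B i)
      module C (i : Fin N) = Comparison k D G 0<D D-slack (B i)
      cols = allColorings n k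
      Ω = properColorings G k

    block : Fin n → Fin N
    block v = proj₁ (covers v)

    sum-block : ∀ v (g : Fin N → ℚ) → sumℚ (allFin N) (λ i → 𝟙 (v ∈? B i) * g i) ≡ g (block v)
    sum-block v g = trans (sum-cong (allFin N) (λ i → cong (_* g i)
      (𝟙-cong (v ∈? B i) (block v ≟ i) (λ v∈ → disjoint (block v) i v (proj₂ (covers v)) v∈) (λ { refl → proj₂ (covers v) }))))
      (sum-δ (block v) g)

    sum-innerDegree : ∀ v → sumℚ (allFin N) (λ i → C.innerDegree i v) ≡ ι (degree G v)
    sum-innerDegree v = begin
      sumℚ (allFin N) (λ i → sumℚ (allFin n) (λ u → 𝟙 (adj? v u) * 𝟙 (u ∈? B i)))
        ≡⟨ sum-swap (allFin N) (allFin n) (λ i u → 𝟙 (adj? v u) * 𝟙 (u ∈? B i)) ⟩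
      sumℚ (allFin n) (λ u → sumℚ (allFin N) (λ i → 𝟙 (adj? v u) * 𝟙 (u ∈? B i)))
        ≡⟨ sum-cong (allFin n) (λ u → trans (sum-cong (allFin N) (λ i → *-comm (𝟙 (adj? v u)) (𝟙 (u ∈? B i)))) (sum-block u (λ _ → 𝟙 (adj? v u)))) ⟩
      sumℚ (allFin n) (λ u → 𝟙 (adj? v u))
        ≡⟨ sym (length-filter (adj? v) (allFin n)) ⟩
      ι (degree G v) ∎
      where open ≡-Reasoning

    innerDegree-nonneg : ∀ i v → 0ℚ ≤ C.innerDegree i v
    innerDegree-nonneg i v = sum-nonneg (allFin n) (λ u → *-nonneg (𝟙-nonneg (adj? v u)) (𝟙-nonneg (u ∈? B i)))

    innerDegree-≤ : ∀ i v → C.innerDegree i v ≤ ι (degree G v)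
    innerDegree-≤ i v = ≤-trans (sum-mono (allFin n) (λ u → ≤-trans (*-monoˡ (𝟙-nonneg (adj? v u)) (𝟙-≤1 (u ∈? B i))) (≤-reflexive (*-identityʳ (𝟙 (adj? v u))))))
      (≤-reflexive (sym (length-filter (adj? v) (allFin n))))

    weight : Fin n → ℚ
    weight v = (1ℚ + ι (degree G v)) - C.innerDegree (block v) v

    1+degree-≤ : ∀ v → 1ℚ + ι (degree G v) ≤ ι D
    1+degree-≤ v = ≤-trans (≤-reflexive (sym (ι-suc (degree G v)))) (ι-mono (degree<D v))

    1≤weight : ∀ v → 1ℚ ≤ weight v
    1≤weight v = ≤-diff (diff-nonneg (innerDegree-≤ (block v) v))
      (solve 2 (λ d i → (con 1ℚ :+ d) :- i := con 1ℚ :+ (d :- i)) refl (ι (degree G v)) (C.innerDegree (block v) v))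

    weight-≤ : ∀ v → weight v ≤ ι D
    weight-≤ v = ≤-trans (≤-diff (innerDegree-nonneg (block v) v)
      (solve 2 (λ p i → p := (p :- i) :+ i) refl (1ℚ + ι (degree G v)) (C.innerDegree (block v) v))) (1+degree-≤ v)

    weight+innerDegree : ∀ v → weight v + C.innerDegree (block v) v ≡ 1ℚ + ι (degree G v)
    weight+innerDegree v = solve 2 (λ p i → (p :- i) :+ i := p) refl (1ℚ + ι (degree G v)) (C.innerDegree (block v) v)

    weight-bound : ∀ i u → u ∈ B i → weight u + C.innerDegree i u ≤ ι D
    weight-bound i u u∈ with disjoint i (block u) u u∈ (proj₂ (covers u))
    ... | refl = ≤-trans (≤-reflexive (weight+innerDegree u)) (1+degree-≤ u)

    step : (Coloring n k → ℚ) → Coloring n k → ℚ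
    step f σ = 1/ N * sumℚ (allFin N) (λ i → U.update i f σ)

    rate : ℚ
    rate = 1ℚ - 1/ N * 1/ D

    -- Every block except that of `v` contributes `L * weight v` plus `L` per neighbour of `v` in
    -- it. The inner degrees over all blocks add up to the degree, and the omitted term is
    -- `L * (1 + degree)` by `weight+innerDegree`, which leaves `N * L * weight v - L`.
    step-osc : ∀ {f L} → 0ℚ ≤ L → Osc f (λ v → L * weight v) → Osc (step f) (λ v → (rate * L) * weight v)
    step-osc {f} {L} 0≤L osc .osc-bound σ v x = begin
      1/ N * sumℚ is (λ i → U.update i f (σ [ v ]≔ x))
        ≤⟨ *-monoˡ (0≤1/ N) (sum-mono is (λ i → osc-bound (C.update-osc i {w = weight} 0≤L (weight-bound i) osc) σ v x)) ⟩
      1/ N * sumℚ is (λ i → U.update i f σ + (Z i - 𝟙 (v ∈? B i) * Z i))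
        ≡⟨ cong (1/ N *_) (trans (sum-+ is (λ i → U.update i f σ) (λ i → Z i - 𝟙 (v ∈? B i) * Z i)) (cong (sumℚ is (λ i → U.update i f σ) +_) total)) ⟩
      1/ N * (sumℚ is (λ i → U.update i f σ) + (ι N * (L * w) - L))
        ≡⟨ solve 5 (λ r s m l w → r :* (s :+ (m :* (l :* w) :- l)) := r :* s :+ ((r :* m) :* (l :* w) :- r :* l)) refl (1/ N) (sumℚ is (λ i → U.update i f σ)) (ι N) L w ⟩
      step f σ + ((1/ N * ι N) * (L * w) - 1/ N * L)
        ≡⟨ cong (λ z → step f σ + (z * (L * w) - 1/ N * L)) (1/-* N 0<N) ⟩
      step f σ + (1ℚ * (L * w) - 1/ N * L)
        ≤⟨ +-monoʳ-≤ (step f σ) contract ⟩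
      step f σ + (rate * L) * w ∎
      where
      open ≤-Reasoning
      is = allFin N
      w = weight v
      d = ι (degree G v)
      Z : Fin N → ℚ
      Z i = L * (w + C.innerDegree i v)
      total : sumℚ is (λ i → Z i - 𝟙 (v ∈? B i) * Z i) ≡ ι N * (L * w) - L
      total = begin-equality
        sumℚ is (λ i → Z i - 𝟙 (v ∈? B i) * Z i)
          ≡⟨ trans (sum-- is Z (λ i → 𝟙 (v ∈? B i) * Z i)) (cong₂ _-_ (sum-*ˡ is L (λ i → w + C.innerDegree i v)) (trans (sum-block v Z) (cong (L *_) (weight+innerDegree v)))) ⟩
        L * sumℚ is (λ i → w + C.innerDegree i v) - L * (1ℚ + d)
          ≡⟨ cong (λ z → L * z - L * (1ℚ + d)) (trans (sum-+ is (λ _ → w) (λ i → C.innerDegree i v)) (cong₂ _+_ (trans (sum-const is w) (cong (λ m → ι m * w) (length-tabulate (λ (i : Fin N) → i)))) (sum-innerDegree v))) ⟩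
        L * (ι N * w + d) - L * (1ℚ + d)
          ≡⟨ solve 4 (λ l m w d → l :* (m :* w :+ d) :- l :* (con 1ℚ :+ d) := m :* (l :* w) :- l) refl L (ι N) w d ⟩
        ι N * (L * w) - L ∎
      -- The loss `L / N` is at least `L * w / (N * D)` because `w ≤ D`; writing `1ℚ` as
      -- `1/ D * ι D` exposes the factor `D - w`.
      contract : 1ℚ * (L * w) - 1/ N * L ≤ (rate * L) * w
      contract = ≤-diff (*-nonneg (*-nonneg (0≤1/ N) 0≤L) (*-nonneg (0≤1/ D) (diff-nonneg (weight-≤ v)))) (begin-equality
        (rate * L) * w
          ≡⟨ solve 4 (λ r e l w → ((con 1ℚ :- r :* e) :* l) :* w := (con 1ℚ :* (l :* w) :- r :* l) :+ (r :* l) :* (con 1ℚ :- e :* w)) refl (1/ N) (1/ D) L w ⟩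
        (1ℚ * (L * w) - 1/ N * L) + (1/ N * L) * (1ℚ - 1/ D * w)
          ≡⟨ cong (λ z → (1ℚ * (L * w) - 1/ N * L) + (1/ N * L) * (z - 1/ D * w)) (sym (1/-* D 0<D)) ⟩
        (1ℚ * (L * w) - 1/ N * L) + (1/ N * L) * (1/ D * ι D - 1/ D * w)
          ≡⟨ solve 5 (λ p q e m w → p :+ q :* (e :* m :- e :* w) := p :+ q :* (e :* (m :- w))) refl (1ℚ * (L * w) - 1/ N * L) (1/ N * L) (1/ D) (ι D) w ⟩
        (1ℚ * (L * w) - 1/ N * L) + (1/ N * L) * (1/ D * (ι D - w)) ∎)

    0≤rate : 0ℚ ≤ rate
    0≤rate = diff-nonneg (≤-trans (*-monoʳ (0≤1/ D) (1/-antimono {1} ℕ.≤-refl 0<N)) (*-monoˡ 0≤1 (1/-antimono {1} ℕ.≤-refl 0<D)))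

    -- Backward evolution: `step` hits `f` before the remaining steps because `distribution` appends
    -- its last `transition` at the end. From a proper `σ`, `steps t f σ` is the expectation of `f`
    -- after `t` steps.
    steps : ℕ → (Coloring n k → ℚ) → Coloring n k → ℚ
    steps zero    f = f
    steps (suc t) f = steps t (step f)

    steps-osc : ∀ t {f L} → 0ℚ ≤ L → Osc f (λ v → L * weight v) → Osc (steps t f) (λ v → (pow rate t * L) * weight v)
    steps-osc zero    {f} {L} 0≤L osc = osc-mono osc (λ v → ≤-reflexive (cong (_* weight v) (sym (*-identityˡ L))))
    steps-osc (suc t) {f} {L} 0≤L osc = osc-mono (steps-osc t {step f} {rate * L} (*-nonneg 0≤rate 0≤L) (step-osc 0≤L osc))
      (λ v → ≤-reflexive (cong (_* weight v) (solve 3 (λ p r l → p :* (r :* l) := (r :* p) :* l) refl (pow rate t) rate L)))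

    -- Expectations of the chain as iterates of `step`

    Proper-Ω : ∀ {σ} → σ ∈ˡ Ω → Proper G k σ
    Proper-Ω {σ} σ∈ = proj₂ (∈-filter⁻ (proper? G k) {xs = cols} σ∈)

    recoloring-proper : ∀ i σ τ → Proper G k σ → U.Resample i σ τ → IsRecoloring G k (B i) σ τ
    recoloring-proper i σ τ σ-proper (fr , agree) = τ-proper , agree
      where
      τ-proper : Proper G k τ
      τ-proper u v uv eq with u ∈? B i | v ∈? B i
      ... | yes u∈ | _      = fr u u∈ v uv eq
      ... | no  _  | yes v∈ = fr v v∈ u (adj-sym uv) (sym eq)
      ... | no u∉  | no v∉  = σ-proper u v uv (trans (sym (agree u u∉)) (trans eq (agree v v∉)))

    -- For proper `σ` the two notions agree: an edge meeting `B i` is checked by `Resample`, and an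
    -- edge outside `B i` keeps its colours from `σ`.
    resamples≡recolorings : ∀ i σ → Proper G k σ → U.resamples i σ ≡ recolorings G k (B i) σ
    resamples≡recolorings i σ σ-proper = filter-≐ (U.resample? i σ) (isRecoloring? G k (B i) σ)
      ((λ {τ} → recoloring-proper i σ τ σ-proper) , λ (pr , agree) → (λ u _ v uv → pr u v uv) , agree) cols

    updateProb-𝟙 : ∀ i σ τ → updateProb G k (B i) σ τ ≡ 𝟙 (isRecoloring? G k (B i) σ τ) * 1/ (length (recolorings G k (B i) σ))
    updateProb-𝟙 i σ τ with does (isRecoloring? G k (B i) σ τ)
    ... | true  = sym (*-identityˡ (1/ (length (recolorings G k (B i) σ))))
    ... | false = sym (*-zeroˡ (1/ (length (recolorings G k (B i) σ))))

    sum-updateProb : ∀ i σ → Proper G k σ → ∀ f → sumℚ Ω (λ τ → updateProb G k (B i) σ τ * f τ) ≡ U.update i f σ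
    sum-updateProb i σ σ-proper f = begin
      sumℚ Ω (λ τ → updateProb G k (B i) σ τ * f τ)
        ≡⟨ sum-filter (proper? G k) cols (λ τ → updateProb G k (B i) σ τ * f τ) ⟩
      sumℚ cols (λ τ → 𝟙 (proper? G k τ) * (updateProb G k (B i) σ τ * f τ))
        ≡⟨ sum-cong cols pointwise ⟩
      sumℚ cols (λ τ → q * (𝟙 (rec? τ) * f τ))
        ≡⟨ sum-*ˡ cols q (λ τ → 𝟙 (rec? τ) * f τ) ⟩
      q * sumℚ cols (λ τ → 𝟙 (rec? τ) * f τ)
        ≡⟨ cong (q *_) (sym (sum-filter rec? cols f)) ⟩
      avg (recolorings G k (B i) σ) f
        ≡⟨ cong (λ rs → avg rs f) (sym (resamples≡recolorings i σ σ-proper)) ⟩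
      U.update i f σ ∎
      where
      open ≡-Reasoning
      rec? = isRecoloring? G k (B i) σ
      q = 1/ (length (recolorings G k (B i) σ))
      absorb : ∀ τ → 𝟙 (proper? G k τ) * 𝟙 (rec? τ) ≡ 𝟙 (rec? τ)
      absorb τ = trans (sym (𝟙-× (proper? G k τ) (rec? τ))) (𝟙-cong (proper? G k τ ×-dec rec? τ) (rec? τ) proj₂ (λ r → proj₁ r , r))
      pointwise : ∀ τ → 𝟙 (proper? G k τ) * (updateProb G k (B i) σ τ * f τ) ≡ q * (𝟙 (rec? τ) * f τ)
      pointwise τ = begin
        𝟙 (proper? G k τ) * (updateProb G k (B i) σ τ * f τ)     ≡⟨ cong (λ z → 𝟙 (proper? G k τ) * (z * f τ)) (updateProb-𝟙 i σ τ) ⟩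
        𝟙 (proper? G k τ) * ((𝟙 (rec? τ) * q) * f τ)             ≡⟨ solve 4 (λ a b c d → a :* ((b :* c) :* d) := c :* ((a :* b) :* d)) refl (𝟙 (proper? G k τ)) (𝟙 (rec? τ)) q (f τ) ⟩
        q * ((𝟙 (proper? G k τ) * 𝟙 (rec? τ)) * f τ)             ≡⟨ cong (λ z → q * (z * f τ)) (absorb τ) ⟩
        q * (𝟙 (rec? τ) * f τ)                                   ∎

    sum-transition : ∀ σ → Proper G k σ → ∀ f → sumℚ Ω (λ τ → transition G k B σ τ * f τ) ≡ step f σ
    sum-transition σ σ-proper f = begin
      sumℚ Ω (λ τ → (1/ N * sumℚ is (λ i → updateProb G k (B i) σ τ)) * f τ)
        ≡⟨ sum-cong Ω (λ τ → trans (*-assoc (1/ N) (sumℚ is (λ i → updateProb G k (B i) σ τ)) (f τ)) (cong (1/ N *_) (sym (sum-*ʳ is (f τ) (λ i → updateProb G k (B i) σ τ))))) ⟩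
      sumℚ Ω (λ τ → 1/ N * sumℚ is (λ i → updateProb G k (B i) σ τ * f τ))
        ≡⟨ sum-*ˡ Ω (1/ N) (λ τ → sumℚ is (λ i → updateProb G k (B i) σ τ * f τ)) ⟩
      1/ N * sumℚ Ω (λ τ → sumℚ is (λ i → updateProb G k (B i) σ τ * f τ))
        ≡⟨ cong (1/ N *_) (sum-swap Ω is (λ τ i → updateProb G k (B i) σ τ * f τ)) ⟩
      1/ N * sumℚ is (λ i → sumℚ Ω (λ τ → updateProb G k (B i) σ τ * f τ))
        ≡⟨ cong (1/ N *_) (sum-cong is (λ i → sum-updateProb i σ σ-proper f)) ⟩
      step f σ ∎
      where
      open ≡-Reasoning
      is = allFin N

    sum-distribution : ∀ t σ → Proper G k σ → ∀ f → sumℚ Ω (λ τ → distribution G k B t σ τ * f τ) ≡ steps t f σ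
    sum-distribution zero σ σ-proper f = begin
      sumℚ Ω (λ τ → 𝟙 (≡-dec _≟_ σ τ) * f τ)
        ≡⟨ sum-filter (proper? G k) cols (λ τ → 𝟙 (≡-dec _≟_ σ τ) * f τ) ⟩
      sumℚ cols (λ τ → 𝟙 (proper? G k τ) * (𝟙 (≡-dec _≟_ σ τ) * f τ))
        ≡⟨ sum-cong cols (λ τ → solve 3 (λ a b c → a :* (b :* c) := b :* (a :* c)) refl (𝟙 (proper? G k τ)) (𝟙 (≡-dec _≟_ σ τ)) (f τ)) ⟩
      sumℚ cols (λ τ → 𝟙 (≡-dec _≟_ σ τ) * (𝟙 (proper? G k τ) * f τ))
        ≡⟨ sum-δ-coloring σ (λ τ → 𝟙 (proper? G k τ) * f τ) ⟩
      𝟙 (proper? G k σ) * f σ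
        ≡⟨ trans (cong (_* f σ) (𝟙-yes (proper? G k σ) σ-proper)) (*-identityˡ (f σ)) ⟩
      f σ ∎
      where open ≡-Reasoning
    sum-distribution (suc t) σ σ-proper f = begin
      sumℚ Ω (λ τ → sumℚ Ω (λ ρ → p ρ * transition G k B ρ τ) * f τ)
        ≡⟨ sum-cong Ω (λ τ → trans (sym (sum-*ʳ Ω (f τ) (λ ρ → p ρ * transition G k B ρ τ))) (sum-cong Ω (λ ρ → *-assoc (p ρ) (transition G k B ρ τ) (f τ)))) ⟩
      sumℚ Ω (λ τ → sumℚ Ω (λ ρ → p ρ * (transition G k B ρ τ * f τ)))
        ≡⟨ sum-swap Ω Ω (λ τ ρ → p ρ * (transition G k B ρ τ * f τ)) ⟩
      sumℚ Ω (λ ρ → sumℚ Ω (λ τ → p ρ * (transition G k B ρ τ * f τ)))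
        ≡⟨ sum-cong-∈ Ω (λ {ρ} ρ∈ → trans (sum-*ˡ Ω (p ρ) (λ τ → transition G k B ρ τ * f τ)) (cong (p ρ *_) (sum-transition ρ (Proper-Ω ρ∈) f))) ⟩
      sumℚ Ω (λ ρ → p ρ * step f ρ)
        ≡⟨ sum-distribution t σ σ-proper (step f) ⟩
      steps t (step f) σ ∎
      where
      open ≡-Reasoning
      p = distribution G k B t σ

    -- Stationarity of the uniform distribution and distance from it

    recolorings-cong : ∀ i σ τ → AgreeOutside G k (B i) σ τ → recolorings G k (B i) σ ≡ recolorings G k (B i) τ
    recolorings-cong i σ τ agree = filter-≐ (isRecoloring? G k (B i) σ) (isRecoloring? G k (B i) τ)
      ((λ (pr , ag) → pr , λ v v∉ → trans (ag v v∉) (sym (agree v v∉))) ,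
       (λ (pr , ag) → pr , λ v v∉ → trans (ag v v∉) (agree v v∉))) cols

    -- Detailed balance: proper colourings that agree outside `B i` have the same recolourings, so
    -- they reach each other with equal probability.
    updateProb-sym : ∀ i σ τ → Proper G k σ → Proper G k τ → updateProb G k (B i) σ τ ≡ updateProb G k (B i) τ σ
    updateProb-sym i σ τ σ-proper τ-proper = trans (updateProb-𝟙 i σ τ) (trans (by-cases (isRecoloring? G k (B i) σ τ)) (sym (updateProb-𝟙 i τ σ)))
      where
      q : Coloring n k → ℚ
      q ρ = 1/ (length (recolorings G k (B i) ρ))
      by-cases : (d : Dec (IsRecoloring G k (B i) σ τ)) → 𝟙 d * q σ ≡ 𝟙 (isRecoloring? G k (B i) τ σ) * q τ
      by-cases (yes (_ , agree)) = cong₂ _*_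
        (sym (𝟙-yes (isRecoloring? G k (B i) τ σ) (σ-proper , λ v v∉ → sym (agree v v∉))))
        (cong (λ rs → 1/ (length rs)) (recolorings-cong i σ τ agree))
      by-cases (no ¬rec) = trans (*-zeroˡ (q σ)) (sym (trans (cong (_* q τ)
        (𝟙-no (isRecoloring? G k (B i) τ σ) (λ (_ , agree) → ¬rec (τ-proper , λ v v∉ → sym (agree v v∉))))) (*-zeroˡ (q τ))))

    -- By symmetry the sum over starting points becomes a sum over targets, which is the block
    -- update of a constant and hence that constant.
    sum-update : ∀ i f → sumℚ Ω (U.update i f) ≡ sumℚ Ω f
    sum-update i f = begin
      sumℚ Ω (U.update i f)
        ≡⟨ sum-cong-∈ Ω (λ {σ} σ∈ → sym (sum-updateProb i σ (Proper-Ω σ∈) f)) ⟩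
      sumℚ Ω (λ σ → sumℚ Ω (λ τ → updateProb G k (B i) σ τ * f τ))
        ≡⟨ sum-swap Ω Ω (λ σ τ → updateProb G k (B i) σ τ * f τ) ⟩
      sumℚ Ω (λ τ → sumℚ Ω (λ σ → updateProb G k (B i) σ τ * f τ))
        ≡⟨ sum-cong-∈ Ω (λ {τ} τ∈ → begin
             sumℚ Ω (λ σ → updateProb G k (B i) σ τ * f τ)   ≡⟨ sum-cong-∈ Ω (λ {σ} σ∈ → cong (_* f τ) (updateProb-sym i σ τ (Proper-Ω σ∈) (Proper-Ω τ∈))) ⟩
             sumℚ Ω (λ σ → updateProb G k (B i) τ σ * f τ)   ≡⟨ sum-updateProb i τ (Proper-Ω τ∈) (λ _ → f τ) ⟩
             avg (U.resamples i τ) (λ _ → f τ)               ≡⟨ avg-const (U.resamples i τ) (U.0<resamples i τ) (f τ) ⟩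
             f τ                                             ∎) ⟩
      sumℚ Ω f ∎
      where open ≡-Reasoning

    sum-step : ∀ f → sumℚ Ω (step f) ≡ sumℚ Ω f
    sum-step f = begin
      sumℚ Ω (λ σ → 1/ N * sumℚ is (λ i → U.update i f σ))   ≡⟨ sum-*ˡ Ω (1/ N) (λ σ → sumℚ is (λ i → U.update i f σ)) ⟩
      1/ N * sumℚ Ω (λ σ → sumℚ is (λ i → U.update i f σ))   ≡⟨ cong (1/ N *_) (sum-swap Ω is (λ σ i → U.update i f σ)) ⟩
      1/ N * sumℚ is (λ i → sumℚ Ω (U.update i f))           ≡⟨ cong (1/ N *_) (sum-cong is (λ i → sum-update i f)) ⟩
      1/ N * sumℚ is (λ _ → sumℚ Ω f)                        ≡⟨ cong (λ m → 1/ m * sumℚ is (λ _ → sumℚ Ω f)) (sym (length-tabulate (λ (i : Fin N) → i))) ⟩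
      avg is (λ _ → sumℚ Ω f)                                ≡⟨ avg-const is (subst (0 ℕ.<_) (sym (length-tabulate (λ (i : Fin N) → i))) 0<N) (sumℚ Ω f) ⟩
      sumℚ Ω f                                               ∎
      where
      open ≡-Reasoning
      is = allFin N

    sum-steps : ∀ t f → sumℚ Ω (steps t f) ≡ sumℚ Ω f
    sum-steps zero    f = refl
    sum-steps (suc t) f = trans (sum-steps t (step f)) (sum-step f)

    -- The deviations are tested against their sign `s`. By stationarity the sum equals the value of
    -- `steps t s` at `σ` minus its average over the proper colourings, which is at most the total
    -- oscillation; the factor `½` cancels the `2` by which a sign can change.
    tv-≤ : ∀ t σ → Proper G k σ → tvToUniform G k B t σ ≤ pow rate t * ι (n ℕ.* D)
    tv-≤ t σ σ-proper = begin
      ½ * sumℚ Ω (λ τ → ∣ p τ - u ∣)                        ≡⟨ cong (½ *_) dual ⟩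
      ½ * (steps t s σ - avg Ω (steps t s))                 ≤⟨ *-monoˡ 0≤½ (≤-trans (+-monoˡ-≤ (- avg Ω (steps t s)) close) (≤-reflexive (solve 2 (λ a b → (a :+ b) :- a := b) refl (avg Ω (steps t s)) diam))) ⟩
      ½ * sumℚ (allFin n) (λ v → (pow rate t * (1ℚ + 1ℚ)) * weight v)
                                                            ≤⟨ *-monoˡ 0≤½ (sum-mono (allFin n) (λ v → *-monoˡ (*-nonneg (pow-nonneg 0≤rate t) 0≤2) (weight-≤ v))) ⟩
      ½ * sumℚ (allFin n) (λ v → (pow rate t * (1ℚ + 1ℚ)) * ι D)
                                                            ≡⟨ cong (½ *_) (trans (sum-const (allFin n) ((pow rate t * (1ℚ + 1ℚ)) * ι D)) (cong (λ m → ι m * ((pow rate t * (1ℚ + 1ℚ)) * ι D)) (length-tabulate (λ (v : Fin n) → v)))) ⟩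
      ½ * (ι n * ((pow rate t * (1ℚ + 1ℚ)) * ι D))          ≡⟨ solve 3 (λ r m d → con ½ :* (m :* ((r :* (con 1ℚ :+ con 1ℚ)) :* d)) := r :* (m :* d)) refl (pow rate t) (ι n) (ι D) ⟩
      pow rate t * (ι n * ι D)                              ≡⟨ cong (pow rate t *_) (sym (ι-* n D)) ⟩
      pow rate t * ι (n ℕ.* D)                              ∎
      where
      open ≤-Reasoning
      0≤½ : 0ℚ ≤ ½
      0≤½ = nonNegative⁻¹ ½
      0≤2 : 0ℚ ≤ 1ℚ + 1ℚ
      0≤2 = +-nonneg 0≤1 0≤1
      u : ℚ
      u = uniform G k
      p s : Coloring n k → ℚ
      p = distribution G k B t σ
      s τ = sign (p τ - u)
      diam : ℚ
      diam = sumℚ (allFin n) (λ v → (pow rate t * (1ℚ + 1ℚ)) * weight v)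
      -- A sign changes by at most `2`, and every weight is at least one.
      s-osc : Osc s (λ v → (1ℚ + 1ℚ) * weight v)
      s-osc .osc-bound ρ v x = ≤-trans (sign-≤ (p (ρ [ v ]≔ x) - u) (p ρ - u))
        (+-monoʳ-≤ (s ρ) (≤-trans (≤-reflexive (sym (*-identityʳ (1ℚ + 1ℚ)))) (*-monoˡ 0≤2 (1≤weight v))))
      steps-s-osc : Osc (steps t s) (λ v → (pow rate t * (1ℚ + 1ℚ)) * weight v)
      steps-s-osc = steps-osc t 0≤2 s-osc
      0<Ω : 0 ℕ.< length Ω
      0<Ω = ∈-length (∈-filter⁺ (proper? G k) (∈-allColorings σ) σ-proper)
      close : steps t s σ ≤ avg Ω (steps t s) + diam
      close = ≤-trans (avg-≥ Ω 0<Ω (λ {ρ} _ → osc-total steps-s-osc (osc-nonneg steps-s-osc σ) ρ σ (λ v → inj₂ ≤-refl)))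
        (≤-reflexive (avg-+const Ω 0<Ω (steps t s) diam))
      dual : sumℚ Ω (λ τ → ∣ p τ - u ∣) ≡ steps t s σ - avg Ω (steps t s)
      dual = begin-equality
        sumℚ Ω (λ τ → ∣ p τ - u ∣)                          ≡⟨ sum-cong Ω (λ τ → trans (∣p∣≡p*signᵈ (p τ - u) (0ℚ ≤? (p τ - u))) (solve 3 (λ a b c → (a :- b) :* c := a :* c :- b :* c) refl (p τ) u (s τ))) ⟩
        sumℚ Ω (λ τ → p τ * s τ - u * s τ)                  ≡⟨ sum-- Ω (λ τ → p τ * s τ) (λ τ → u * s τ) ⟩
        sumℚ Ω (λ τ → p τ * s τ) - sumℚ Ω (λ τ → u * s τ)   ≡⟨ cong₂ _-_ (sum-distribution t σ σ-proper s) (trans (sum-*ˡ Ω u s) (cong (u *_) (sym (sum-steps t s)))) ⟩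
        steps t s σ - avg Ω (steps t s)                     ∎

  -- From the contraction rate to a mixing time

  pow-mono : ∀ {x y} → 0ℚ ≤ x → x ≤ y → ∀ m → pow x m ≤ pow y m
  pow-mono 0≤x x≤y zero    = ≤-refl
  pow-mono {x} {y} 0≤x x≤y (suc m) = ≤-trans (*-monoʳ (pow-nonneg 0≤x m) x≤y) (*-monoˡ (≤-trans 0≤x x≤y) (pow-mono 0≤x x≤y m))

  pow-+ : ∀ x l m → pow x (l ℕ.+ m) ≡ pow x l * pow x m
  pow-+ x zero    m = sym (*-identityˡ (pow x m))
  pow-+ x (suc l) m = trans (cong (x *_) (pow-+ x l m)) (sym (*-assoc x (pow x l) (pow x m)))

  pow-*ʳ : ∀ x l m → pow x (m ℕ.* l) ≡ pow (pow x l) m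
  pow-*ʳ x l zero    = refl
  pow-*ʳ x l (suc m) = trans (pow-+ x l (m ℕ.* l)) (cong (pow x l *_) (pow-*ʳ x l m))

  pow-½ : ∀ s → pow ½ s * ι (2 ℕ.^ s) ≡ 1ℚ
  pow-½ zero    = refl
  pow-½ (suc s) = begin
    (½ * pow ½ s) * ι (2 ℕ.* 2 ℕ.^ s)        ≡⟨ cong ((½ * pow ½ s) *_) (ι-* 2 (2 ℕ.^ s)) ⟩
    (½ * pow ½ s) * (ι 2 * ι (2 ℕ.^ s))      ≡⟨ solve 2 (λ p q → (con ½ :* p) :* (con (ι 2) :* q) := p :* q) refl (pow ½ s) (ι (2 ℕ.^ s)) ⟩
    pow ½ s * ι (2 ℕ.^ s)                    ≡⟨ pow-½ s ⟩
    1ℚ                                       ∎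
    where open ≡-Reasoning

  -- The product form keeps division out; the induction step loses exactly `P * (x * x) * (1 + m)`.
  bernoulli : ∀ {x} → 0ℚ ≤ x → x ≤ 1ℚ → ∀ m → pow (1ℚ - x) m * (1ℚ + ι m * x) ≤ 1ℚ
  bernoulli {x} 0≤x x≤1 zero    = ≤-reflexive (solve 1 (λ x → con 1ℚ :* (con 1ℚ :+ con 0ℚ :* x) := con 1ℚ) refl x)
  bernoulli {x} 0≤x x≤1 (suc m) = begin
    ((1ℚ - x) * P) * (1ℚ + ι (suc m) * x)    ≡⟨ cong (λ z → ((1ℚ - x) * P) * (1ℚ + z * x)) (ι-suc m) ⟩
    ((1ℚ - x) * P) * (1ℚ + (1ℚ + ι m) * x)   ≤⟨ ≤-diff (*-nonneg (pow-nonneg (diff-nonneg x≤1) m) (*-nonneg (*-nonneg 0≤x 0≤x) (+-nonneg 0≤1 (0≤ι m))))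
                                                  (solve 3 (λ x p j → p :* (con 1ℚ :+ j :* x) := ((con 1ℚ :- x) :* p) :* (con 1ℚ :+ (con 1ℚ :+ j) :* x) :+ p :* ((x :* x) :* (con 1ℚ :+ j))) refl x P (ι m)) ⟩
    P * (1ℚ + ι m * x)                       ≤⟨ bernoulli 0≤x x≤1 m ⟩
    1ℚ                                       ∎
    where
    open ≤-Reasoning
    P = pow (1ℚ - x) m

  pow-≤-½ : ∀ {x} → 0ℚ ≤ x → x ≤ 1ℚ → ∀ m → ι m * x ≡ 1ℚ → pow (1ℚ - x) m ≤ ½
  pow-≤-½ {x} 0≤x x≤1 m mx≡1 = begin
    P                                ≡⟨ solve 1 (λ p → p := con ½ :* (p :* (con 1ℚ :+ con 1ℚ))) refl P ⟩
    ½ * (P * (1ℚ + 1ℚ))              ≡⟨ cong (λ z → ½ * (P * (1ℚ + z))) (sym mx≡1) ⟩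
    ½ * (P * (1ℚ + ι m * x))         ≤⟨ *-monoˡ (nonNegative⁻¹ ½) (bernoulli 0≤x x≤1 m) ⟩
    ½ * 1ℚ                           ≡⟨ *-identityʳ ½ ⟩
    ½                                ∎
    where
    open ≤-Reasoning
    P = pow (1ℚ - x) m

  least : {P : ℕ → Set} → (∀ t → Dec (P t)) → ∀ t → P t → ∃[ T ] (P T × (∀ t′ → P t′ → T ℕ.≤ t′))
  least P? zero    p = zero , p , λ _ _ → ℕ.z≤n
  least {P} P? (suc t) p with P? zero
  ... | yes p₀ = zero , p₀ , λ _ _ → ℕ.z≤n
  ... | no ¬p₀ with least {P ∘ suc} (P? ∘ suc) t p
  ...   | T , pT , min = suc T , pT , λ { zero p₀ → ⊥-elim (¬p₀ p₀) ; (suc t′) p′ → ℕ.s≤s (min t′ p′) }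

  -- Decidability lets `least` turn some time at which the chain has mixed into the mixing time; it
  -- is a finite check, since colourings are listed and rationals can be compared.
  mixedAt? : ∀ {n N} (G : Graph n) k (B : Fin N → Subset n) t → Dec (MixedAt G k B t)
  mixedAt? G k B t = map′ (λ all σ → All.lookup all (∈-allColorings σ)) (λ mixed → All.universal mixed (allColorings _ k))
    (All.all? (λ σ → proper? G k σ →-dec (tvToUniform G k B t σ ≤? (ℤ.+ 1 / 4))) (allColorings _ k))

  module _ {n N : ℕ} (k D : ℕ) (G : Graph n) (D-slack : ∀ u → degree G u ℕ.+ D ℕ.≤ k)
    (degree<D : ∀ u → degree G u ℕ.< D) (0<D : 0 ℕ.< D) (0<N : 0 ℕ.< N)
    (B : Fin N → Subset n) (partition : IsPartition B) where
    open BlockDynamics k D G D-slack degree<D 0<D 0<N B partition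

    -- As `rate` is `1 - 1 / (N * D)`, each run of `N * D` steps at least halves the bound, and `s`
    -- halvings bring `n * D` down to a quarter.
    mixedAt : ∀ s → 4 ℕ.* (n ℕ.* D) ℕ.≤ 2 ℕ.^ s → MixedAt G k B (s ℕ.* (N ℕ.* D))
    mixedAt s large σ σ-proper = begin
      tvToUniform G k B (s ℕ.* (N ℕ.* D)) σ                ≤⟨ tv-≤ (s ℕ.* (N ℕ.* D)) σ σ-proper ⟩
      pow rate (s ℕ.* (N ℕ.* D)) * ι (n ℕ.* D)             ≡⟨ cong (_* ι (n ℕ.* D)) (pow-*ʳ rate (N ℕ.* D) s) ⟩
      pow (pow rate (N ℕ.* D)) s * ι (n ℕ.* D)             ≤⟨ *-monoʳ (0≤ι (n ℕ.* D)) (pow-mono (pow-nonneg 0≤rate (N ℕ.* D)) (pow-≤-½ 0≤x x≤1 (N ℕ.* D) ND-x) s) ⟩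
      pow ½ s * ι (n ℕ.* D)                                ≡⟨ solve 2 (λ p q → p :* q := con (ℤ.+ 1 / 4) :* (p :* (con (ι 4) :* q))) refl (pow ½ s) (ι (n ℕ.* D)) ⟩
      (ℤ.+ 1 / 4) * (pow ½ s * (ι 4 * ι (n ℕ.* D)))        ≡⟨ cong (λ z → (ℤ.+ 1 / 4) * (pow ½ s * z)) (sym (ι-* 4 (n ℕ.* D))) ⟩
      (ℤ.+ 1 / 4) * (pow ½ s * ι (4 ℕ.* (n ℕ.* D)))        ≤⟨ *-monoˡ (nonNegative⁻¹ (ℤ.+ 1 / 4)) (*-monoˡ (pow-nonneg (nonNegative⁻¹ ½) s) (ι-mono large)) ⟩
      (ℤ.+ 1 / 4) * (pow ½ s * ι (2 ℕ.^ s))                ≡⟨ trans (cong ((ℤ.+ 1 / 4) *_) (pow-½ s)) (*-identityʳ (ℤ.+ 1 / 4)) ⟩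
      ℤ.+ 1 / 4                                            ∎
      where
      open ≤-Reasoning
      x : ℚ
      x = 1/ N * 1/ D
      0≤x : 0ℚ ≤ x
      0≤x = *-nonneg (0≤1/ N) (0≤1/ D)
      x≤1 : x ≤ 1ℚ
      x≤1 = ≤-diff 0≤rate (solve 1 (λ x → con 1ℚ := x :+ (con 1ℚ :- x)) refl x)
      ND-x : ι (N ℕ.* D) * x ≡ 1ℚ
      ND-x = begin-equality
        ι (N ℕ.* D) * (1/ N * 1/ D)          ≡⟨ cong (_* (1/ N * 1/ D)) (ι-* N D) ⟩
        (ι N * ι D) * (1/ N * 1/ D)          ≡⟨ solve 4 (λ a b c d → (a :* b) :* (c :* d) := (c :* a) :* (d :* b)) refl (ι N) (ι D) (1/ N) (1/ D) ⟩
        (1/ N * ι N) * (1/ D * ι D)          ≡⟨ cong₂ _*_ (1/-* N 0<N) (1/-* D 0<D) ⟩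
        1ℚ                                   ∎

-- Numerical bounds

module Bounds where

  -- The exponent grows only when `m` has reached `2 ^ s`, so the power never exceeds twice the
  -- argument.
  log₂-between : ∀ m → 1 ℕ.≤ m → ∃[ s ] (m ℕ.≤ 2 ℕ.^ s × 2 ℕ.^ s ℕ.≤ 2 ℕ.* m)
  log₂-between (suc zero) _ = 0 , ℕ.≤-refl , ℕ.s≤s ℕ.z≤n
  log₂-between (suc m@(suc m′)) _ with log₂-between m (ℕ.s≤s ℕ.z≤n)
  ... | s , m≤2^s , 2^s≤2m with suc m ℕ.≤? 2 ℕ.^ s
  ...   | yes m<2^s = s , m<2^s , ℕ.≤-trans 2^s≤2m (ℕ.*-monoʳ-≤ 2 (ℕ.n≤1+n m))
  ...   | no  m≮2^s = suc s , ℕ.≤-trans suc-m≤2m (ℕ.*-monoʳ-≤ 2 m≤2^s) ,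
            ℕ.*-monoʳ-≤ 2 (ℕ.≤-trans (ℕ.≤-pred (ℕ.≰⇒> m≮2^s)) (ℕ.n≤1+n m))
    where
    suc-m≤2m : suc m ℕ.≤ 2 ℕ.* m
    suc-m≤2m = ℕ.+-mono-≤ {1} (ℕ.s≤s ℕ.z≤n) (ℕ.m≤m+n m 0)

  degree≤maxDegree : ∀ {n} (G : Graph n) u → degree G u ℕ.≤ maxDegree G
  degree≤maxDegree {n} G u = All.lookup (xs≤max 0 (map (degree G) (allFin n))) (∈-map⁺ (degree G) (∈-allFin u))

  degree<n : ∀ {n} (G : Graph n) u → degree G u ℕ.< n
  degree<n {n} G u = subst (degree G u ℕ.<_) (length-tabulate (λ (v : Fin n) → v))
    (filter-notAll (Graph.adj? G u) (allFin n) (lose (∈-allFin u) (Graph.no-loop G u)))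

  -- A positive maximum degree excludes `n = 0`; beyond that, no vertex is its own neighbour.
  maxDegree<n : ∀ {n} (G : Graph n) → 1 ℕ.≤ maxDegree G → maxDegree G ℕ.< n
  maxDegree<n {suc n} G _ = max<v⁺ (ℕ.s≤s ℕ.z≤n) (All.map⁺ (All.universal (degree<n G) (allFin (suc n))))

  blocks≤n : ∀ {n N} {B : Fin N → Subset n} → IsPartition B → N ℕ.≤ n
  blocks≤n {B = B} partition = injective⇒≤ {f = λ i → proj₁ (nonempty i)}
    (λ {i} {j} eq → disjoint i j (proj₁ (nonempty i)) (proj₂ (nonempty i)) (subst (_∈ B j) (sym eq) (proj₂ (nonempty j))))
    where open IsPartition partition

  blocks>0 : ∀ {n N} {B : Fin N → Subset n} → IsPartition B → 0 ℕ.< n → 0 ℕ.< N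
  blocks>0 {suc n} {suc N} partition _ = ℕ.s≤s ℕ.z≤n
  blocks>0 {suc n} {zero}  partition _ with proj₁ (IsPartition.covers partition zero)
  ... | ()

  4nD≤n⁴ : ∀ n D → 2 ℕ.≤ n → D ℕ.≤ n → 4 ℕ.* (n ℕ.* D) ℕ.≤ n ℕ.^ 4
  4nD≤n⁴ n D 2≤n D≤n = begin
    4 ℕ.* (n ℕ.* D)              ≤⟨ ℕ.*-mono-≤ (ℕ.*-mono-≤ 2≤n 2≤n) (ℕ.*-monoʳ-≤ n D≤n) ⟩
    (n ℕ.* n) ℕ.* (n ℕ.* n)      ≡⟨ solve 1 (λ n → (n :* n) :* (n :* n) := n :^ 4) refl n ⟩
    n ℕ.^ 4                      ∎
    where
    open ℕ.≤-Reasoning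
    open ℕ.+-*-Solver

  -- Origin of the constant `10`: a factor `5` from `2 ^ s ≤ 2 * n ^ 4 ≤ n ^ 5`, and a factor `2`
  -- from `suc Δ ≤ 2 * Δ`.
  time-bound : ∀ n N Δ s → 2 ℕ.≤ n → N ℕ.≤ n → 1 ℕ.≤ Δ → 2 ℕ.^ s ℕ.≤ 2 ℕ.* n ℕ.^ 4 →
    2 ℕ.^ (s ℕ.* (N ℕ.* suc Δ)) ℕ.≤ n ℕ.^ (10 ℕ.* Δ ℕ.* n)
  time-bound n@(suc _) N Δ s 2≤n N≤n 1≤Δ 2^s≤ = begin
    2 ℕ.^ (s ℕ.* (N ℕ.* suc Δ))    ≡⟨ sym (ℕ.^-*-assoc 2 s (N ℕ.* suc Δ)) ⟩
    (2 ℕ.^ s) ℕ.^ (N ℕ.* suc Δ)    ≤⟨ ℕ.^-monoˡ-≤ (N ℕ.* suc Δ) (ℕ.≤-trans 2^s≤ (ℕ.*-monoˡ-≤ (n ℕ.^ 4) 2≤n)) ⟩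
    (n ℕ.^ 5) ℕ.^ (N ℕ.* suc Δ)    ≡⟨ ℕ.^-*-assoc n 5 (N ℕ.* suc Δ) ⟩
    n ℕ.^ (5 ℕ.* (N ℕ.* suc Δ))    ≤⟨ ℕ.^-monoʳ-≤ n exponent ⟩
    n ℕ.^ (10 ℕ.* Δ ℕ.* n)         ∎
    where
    open ℕ.≤-Reasoning
    exponent : 5 ℕ.* (N ℕ.* suc Δ) ℕ.≤ 10 ℕ.* Δ ℕ.* n
    exponent = begin
      5 ℕ.* (N ℕ.* suc Δ)          ≤⟨ ℕ.*-monoʳ-≤ 5 (ℕ.*-mono-≤ N≤n (ℕ.+-monoˡ-≤ Δ 1≤Δ)) ⟩
      5 ℕ.* (n ℕ.* (Δ ℕ.+ Δ))      ≡⟨ solve 2 (λ n Δ → con 5 :* (n :* (Δ :+ Δ)) := con 10 :* Δ :* n) refl n Δ ⟩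
      10 ℕ.* Δ ℕ.* n               ∎
      where open ℕ.+-*-Solver

open import Data.Nat using (_+_; _*_; _≤_; _<_)

theorem3p1 : ∃[ C ] (0 < C ×
    (∀ (g n Δ k N : ℕ) (G : Graph n) (B : Fin N → Subset n) →
    3 ≤ g →
    GirthAtLeast G g →
    maxDegree G ≡ Δ →
    1 ≤ Δ →
    2 * Δ < k →
    IsPartition B →
    (∀ i → ∃[ d ] (IsDiameter G (B i) d × 2 * (d + 3) ≤ g)) →
    ∃[ T ] (IsMixingTime G k B T × T ≤ C * Δ * n ·log₂ n)))
theorem3p1 = 10 , ℕ.s≤s ℕ.z≤n , bound
  where
  open Mixing using (mixedAt; mixedAt?; least)
  open Bounds
  bound : ∀ (g n Δ k N : ℕ) (G : Graph n) (B : Fin N → Subset n) → 3 ≤ g → GirthAtLeast G g → maxDegree G ≡ Δ →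
    1 ≤ Δ → 2 * Δ < k → IsPartition B → (∀ i → ∃[ d ] (IsDiameter G (B i) d × 2 * (d + 3) ≤ g)) →
    ∃[ T ] (IsMixingTime G k B T × T ≤ 10 * Δ * n ·log₂ n)
  bound g n Δ k N G B _ _ refl 1≤Δ 2Δ<k partition _ =
    -- There is an edge, so `n ≥ 2`, and `D = suc Δ` is at most `n`. Hence `4 * (n * D) ≤ n ^ 4`,
    -- and `s` is chosen with `2 ^ s` between `n ^ 4` and its double.
    let Δ<n = maxDegree<n G 1≤Δ
        2≤n = ℕ.≤-trans (ℕ.s≤s 1≤Δ) Δ<n
        1≤n = ℕ.≤-trans (ℕ.n≤1+n 1) 2≤n
        s , n⁴≤2^s , 2^s≤2n⁴ = log₂-between (n ℕ.^ 4) (ℕ.^-monoˡ-≤ 4 1≤n)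
        mixed = mixedAt k (suc Δ) G slack (λ u → ℕ.s≤s (degree≤maxDegree G u)) (ℕ.s≤s ℕ.z≤n) (blocks>0 partition 1≤n) B partition
                  s (ℕ.≤-trans (4nD≤n⁴ n (suc Δ) 2≤n Δ<n) n⁴≤2^s)
        T , T-mixed , T-least = least (mixedAt? G k B) (s * (N * suc Δ)) mixed
    in T , (T-mixed , T-least) ,
       ℕ.≤-trans (ℕ.^-monoʳ-≤ 2 (T-least (s * (N * suc Δ)) mixed)) (time-bound n N Δ s 2≤n (blocks≤n partition) 1≤Δ 2^s≤2n⁴)
    where
    -- The strictness of `2 * Δ < k` pays for the one in `D = suc Δ`, and thereby for the one in
    -- `weight` from which the contraction comes.
    slack : ∀ u → degree G u + suc Δ ≤ k
    slack u = ℕ.≤-trans (ℕ.+-monoˡ-≤ (suc Δ) (degree≤maxDegree G u))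
      (ℕ.≤-trans (ℕ.≤-reflexive (trans (ℕ.+-suc Δ Δ) (cong (λ m → suc (Δ + m)) (sym (ℕ.+-identityʳ Δ))))) 2Δ<k)
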